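{- For each integer $a\ge 0$ let $I_a=\{1,3,5,\ldots,2a+1\}$ (so $s(I_a)=a$). For every nonnegative integer $i$ there exists a unique polynomial $P_i(t)\in\mathbb{Q}[t]$ of degree at most $i$ such that $P_i(a)=\frac{C_{a-i}(I_a)}{C_a(I_a)}$ for all integers $a\ge i$.
   Context: Partitions are drawn as Young diagrams $\mathbb{D}(\lambda)$ in English notation; $c_{i,j}$ is the cell in row $i$, column $j$. The hook length $h_\lambda(c)$ is the number of cells of $\mathbb{D}(\lambda)$ weakly right of $c$ in its row or weakly below $c$ in its column (counting $c$ once). For $\mu\subseteq\lambda$, an excited diagram of $\lambda/\mu$ is a subset of $\mathbb{D}(\lambda)$ obtained from $\mathbb{D}(\mu)$ by repeatedly replacing a cell $c_{i,j}\in D$ by $c_{i+1,j+1}$, allowed iff $c_{i+1,j+1}\in\mathbb{D}(\lambda)$ and none of $c_{i,j+1},c_{i+1,j},c_{i+1,j+1}$ lies in $D$; $\mathbb{E}(\lambda/\mu)$ is their set. A ribbon with $n$ cells is read from its lower-left to its upper-right cell, each successive cell directly right of or directly above the previous; it corresponds to the set of $i\in\{1,\ldots,n-1\}$ with cell $i$ directly below cell $i+1$. A descent set is a non-empty finite set $I$ of positive integers; $\lambda^I$ is the unique partition with $\lambda^I_1=\lambda^I_2$ such that the cells $c_{i,j}\in\mathbb{D}(\lambda^I)$ with fewer than three of $c_{i,j+1},c_{i+1,j},c_{i+1,j+1}$ in $\mathbb{D}(\lambda^I)$ form a ribbon corresponding to $I$; this ribbon is $\mathbb{D}(\lambda^I)\setminus\mathbb{D}(\mu^I)$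 for a partition $\mu^I$. Let $s(I)=\lambda^I_1-1$. Naruse-Newton coefficients: every excited diagram of $\lambda^I/\mu^I$ meets row 1 in $\{c_{1,1},\ldots,c_{1,r}\}$, $0\le r\le s$; for $0\le j\le s(I)$, $C_j(I)=\sum_D\prod_{c\in D,\,c\notin\text{row }1}h_{\lambda^I}(c)$, summed over $D\in\mathbb{E}(\lambda^I/\mu^I)$ with exactly $s-j$ cells in row 1. -}

module Defs where

open import Data.Bool using (Bool; true; false)
open import Data.List using (List; []; _∷_; _++_; map; filter; foldr; length; upTo)
open import Data.List.Membership.Propositional using (_∈_; _∉_)
open import Data.List.Membership.Propositional.Properties
  using (∈-map⁺; ∈-map⁻; ∈-++⁺ˡ; ∈-++⁺ʳ; ∈-++⁻; ∈-upTo⁺; ∈-upTo⁻; foldr-selective)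
open import Data.List.Properties using (filter-all; filter-notAll)
open import Data.List.Relation.Binary.Permutation.Propositional
  using (_↭_; prep; swap; ↭-refl; ↭-sym; ↭-trans)
open import Data.List.Relation.Binary.Permutation.Propositional.Properties
  using (∈-resp-↭; drop-∷; map⁺; ¬x∷xs↭[])
open import Data.List.Relation.Unary.All using (All; []; _∷_)
import Data.List.Relation.Unary.All as All
import Data.List.Relation.Unary.All.Properties as All
open import Data.List.Relation.Unary.Any using (here; there; _─_)
open import Data.List.Relation.Unary.Linked using (Linked; []; [-]; _∷_)
open import Data.Nat
  using (ℕ; zero; suc; _+_; _*_; _∸_; _⊔_; _≤_; _<_; _≥_; z≤n; s≤s; _≤?_; _≟_)
open import Data.Nat.Induction using (<-wellFounded)
open import Data.Nat.ListAction using (sum; product)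
open import Data.Nat.ListAction.Properties using (sum-↭)
open import Data.Nat.Properties
open import Data.Product using (∃; ∃-syntax; ∃₂; _×_; _,_; proj₁; proj₂)
open import Data.Product.Properties using (≡-dec)
open import Data.Rational using (ℚ; 0ℚ)
import Data.Rational as ℚ
open import Data.Sum using (_⊎_; inj₁; inj₂)
open import Function using (_∘_; _⇔_; mk⇔; Equivalence)
open import Induction.WellFounded using (Acc; acc)
open import Relation.Binary.PropositionalEquality
  using (_≡_; _≢_; refl; sym; trans; cong; subst)
open import Relation.Nullary using (Dec; yes; no; does; ¬_; ¬?; contradiction)
open import Relation.Nullary.Decidable using (map′; _×-dec_; _⊎-dec_; dec-true; dec-false)

open Equivalence using (to; from)

------------------------------------------------------------------------
-- Cells and Young diagrams

-- (i , j) is the cell in row i, column j; both coordinates start at 1.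
Cell : Set
Cell = ℕ × ℕ

row col : Cell → ℕ
row = proj₁
col = proj₂

right below diag : Cell → Cell
right (i , j) = i , suc j
below (i , j) = suc i , j
diag  (i , j) = suc i , suc j

_≟ᶜ_ : (c d : Cell) → Dec (c ≡ d)
_≟ᶜ_ = ≡-dec _≟_ _≟_

open import Data.List.Membership.DecPropositional _≟ᶜ_ using () renaming (_∈?_ to _∈ᶜ?_)
open import Data.List.Membership.DecPropositional _≟_ using (_∈?_)

record Partition : Set where
  field
    parts      : List ℕ
    decreasing : Linked _≥_ parts
    positive   : All (0 <_) parts

open Partition public

-- The i-th part, counted from 1; it is 0 when there is no such part.
nth : List ℕ → ℕ → ℕ
nth _        zero          = 0
nth []       (suc _)       = 0
nth (x ∷ _)  1             = x
nth (_ ∷ xs) (suc (suc i)) = nth xs (suc i)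

part : Partition → ℕ → ℕ
part Λ = nth (parts Λ)

-- Lists each cell of the diagram exactly once.
diagram : List ℕ → List Cell
diagram []       = []
diagram (x ∷ xs) = map (λ j → 1 , suc j) (upTo x) ++ map below (diagram xs)

𝔻 : Partition → List Cell
𝔻 Λ = diagram (parts Λ)

hook : Partition → Cell → ℕ
hook Λ c = length (filter inHook? (𝔻 Λ))
  where
  inHook? : (d : Cell) → Dec ((row d ≡ row c × col c ≤ col d) ⊎ (col d ≡ col c × row c ≤ row d))
  inHook? d = ((row d ≟ row c) ×-dec (col c ≤? col d)) ⊎-dec ((col d ≟ col c) ×-dec (row c ≤? row d))

------------------------------------------------------------------------
-- Excited diagrams

-- A finite set of cells is a repetition-free list, considered up to ↭.
Excitable : Partition → List Cell → Cell → Set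
Excitable Λ D c = diag c ∈ 𝔻 Λ × right c ∉ D × below c ∉ D × diag c ∉ D

data Excited (Λ μ : Partition) : List Cell → Set where
  initial : ∀ {D} → D ↭ 𝔻 μ → Excited Λ μ D
  excite  : ∀ {c E D} → Excited Λ μ (c ∷ E) → Excitable Λ (c ∷ E) c →
            D ↭ diag c ∷ E → Excited Λ μ D

-- Decidability of Excited: undo excitations; each one lowers the sum of the
-- row indices.
infix 4 _↭?_

─-↭ : ∀ {x : Cell} {xs} (p : x ∈ xs) → xs ↭ x ∷ (xs ─ p)
─-↭ (here refl)              = ↭-refl
─-↭ {x} {y ∷ xs} (there p) = ↭-trans (prep y (─-↭ p)) (swap y x ↭-refl)

_↭?_ : (xs ys : List Cell) → Dec (xs ↭ ys)
[]       ↭? []       = yes ↭-refl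
[]       ↭? (y ∷ ys) = no (¬x∷xs↭[] ∘ ↭-sym)
(x ∷ xs) ↭? ys with x ∈ᶜ? ys
... | no  x∉ys = no λ p → x∉ys (∈-resp-↭ p (here refl))
... | yes x∈ys = map′ (λ q → ↭-trans (prep x q) (↭-sym (─-↭ x∈ys)))
                      (λ q → drop-∷ (↭-trans q (─-↭ x∈ys)))
                      (xs ↭? (ys ─ x∈ys))

any∈? : ∀ (xs : List Cell) {P : ∀ {x} → x ∈ xs → Set} →
        (∀ {x} (p : x ∈ xs) → Dec (P p)) → Dec (∃₂ λ x (p : x ∈ xs) → P p)
any∈? []       P? = no λ { (_ , () , _) }
any∈? (x ∷ xs) P? with P? (here refl) | any∈? xs (P? ∘ there)
... | yes h | _                = yes (_ , here refl , h)
... | no  _ | yes (_ , p , h)  = yes (_ , there p , h)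
... | no ¬h | no ¬t            = no λ { (_ , here refl , h) → ¬h h
                                      ; (_ , there p , h)   → ¬t (_ , p , h) }

Excitable? : ∀ Λ D c → Dec (Excitable Λ D c)
Excitable? Λ D c = (diag c ∈ᶜ? 𝔻 Λ) ×-dec ¬? (right c ∈ᶜ? D)
                   ×-dec ¬? (below c ∈ᶜ? D) ×-dec ¬? (diag c ∈ᶜ? D)

Excitable-resp-↭ : ∀ {Λ D D′ c} → D ↭ D′ → Excitable Λ D c → Excitable Λ D′ c
Excitable-resp-↭ p (d , r , b , e) =
  d , r ∘ ∈-resp-↭ (↭-sym p) , b ∘ ∈-resp-↭ (↭-sym p) , e ∘ ∈-resp-↭ (↭-sym p)

Excited-resp-↭ : ∀ {Λ μ D D′} → D ↭ D′ → Excited Λ μ D → Excited Λ μ D′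
Excited-resp-↭ p (initial q)    = initial (↭-trans (↭-sym p) q)
Excited-resp-↭ p (excite e m q) = excite e m (↭-trans (↭-sym p) q)

rowSum : List Cell → ℕ
rowSum D = sum (map row D)

-- D results from exciting some c, whose new position is the member x at p.
Undo : ∀ (Λ μ : Partition) {D x} → x ∈ D → Set
Undo Λ μ {D} {x} p = ∃[ c ] diag c ≡ x × Excitable Λ (c ∷ (D ─ p)) c × Excited Λ μ (c ∷ (D ─ p))

undone : ∀ {Λ μ D c E} → Excited Λ μ (c ∷ E) → Excitable Λ (c ∷ E) c → D ↭ diag c ∷ E →
         ∃₂ λ x (p : x ∈ D) → Undo Λ μ p
undone {Λ} {μ} {D} {c} {E} e m q = diag c , p , c , refl , Excitable-resp-↭ {Λ} (prep c r) m ,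
                           Excited-resp-↭ (prep c r) e
  where
  p : diag c ∈ D
  p = ∈-resp-↭ (↭-sym q) (here refl)
  r : E ↭ (D ─ p)
  r = drop-∷ (↭-trans (↭-sym q) (─-↭ p))

excitedAcc? : ∀ Λ μ D → Acc _<_ (rowSum D) → Dec (Excited Λ μ D)
excitedAcc? Λ μ D (acc rs) with D ↭? 𝔻 μ | any∈? D undo?
  where
  smaller : ∀ {c} (p : diag c ∈ D) → rowSum (c ∷ (D ─ p)) < rowSum D
  smaller p = ≤-reflexive (sym (sum-↭ (map⁺ row (─-↭ p))))

  undo? : ∀ {x} (p : x ∈ D) → Dec (Undo Λ μ p)
  undo? {zero , _}      p = no λ { (_ , () , _) }
  undo? {suc _ , zero}  p = no λ { (_ , () , _) }
  undo? {suc i , suc j} p =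
    map′ (λ { (m , e) → (i , j) , refl , m , e })
         (λ { (_ , refl , m , e) → m , e })
         (Excitable? Λ _ (i , j) ×-dec excitedAcc? Λ μ _ (rs (smaller p)))
... | yes q | _ = yes (initial q)
... | no _  | yes (_ , p , c , refl , m , e) = yes (excite e m (─-↭ p))
... | no ¬q | no ¬u = no λ { (initial q) → ¬q q ; (excite e m q) → ¬u (undone e m q) }

excited? : ∀ Λ μ D → Dec (Excited Λ μ D)
excited? Λ μ D = excitedAcc? Λ μ D (<-wellFounded (rowSum D))

-- Each subset of a repetition-free list is listed exactly once, as a sublist.
subsets : List Cell → List (List Cell)
subsets []       = [] ∷ []
subsets (c ∷ cs) = map (c ∷_) (subsets cs) ++ subsets cs

𝔼 : Partition → Partition → List (List Cell)
𝔼 Λ μ = filter (excited? Λ μ) (subsets (𝔻 Λ))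

------------------------------------------------------------------------
-- Descent sets and their ribbon shapes

-- A finite set of positive integers, given by any list with these elements.
record DescentSet : Set where
  field
    elements : List ℕ
    nonempty : elements ≢ []
    positive : All (0 <_) elements

open DescentSet public using (elements)

infix 4 _∈ᴵ_
_∈ᴵ_ : ℕ → DescentSet → Set
i ∈ᴵ I = i ∈ elements I

Border : Partition → Cell → Set
Border Λ c = c ∈ 𝔻 Λ × length (filter (_∈ᶜ? 𝔻 Λ) (right c ∷ below c ∷ diag c ∷ [])) < 3

-- The border cells, read as cell 1, …, cell n from lower left to upper right,
-- form a ribbon corresponding to I.  (Values of cell outside 1, …, n are junk.)
record BorderRibbon (I : DescentSet) (Λ : Partition) : Set where
  field
    n        : ℕ
    cell     : ℕ → Cell
    border   : ∀ c → Border Λ c ⇔ (∃[ k ] 1 ≤ k × k ≤ n × c ≡ cell k)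
    ribbon   : ∀ k → 1 ≤ k → k < n →
               cell (suc k) ≡ right (cell k) ⊎ cell k ≡ below (cell (suc k))
    descents : ∀ k → k ∈ᴵ I ⇔ (1 ≤ k × k < n × cell k ≡ below (cell (suc k)))

-- The defining property of λ^I.
IsRibbonShape : DescentSet → Partition → Set
IsRibbonShape I Λ = part Λ 1 ≡ part Λ 2 × BorderRibbon I Λ

-- λ^I is built by laying its ribbon cell by cell, starting from a single cell:
-- a step up duplicates the first row, a step right lengthens it.
grow : Bool → List ℕ → List ℕ
grow _     []       = []
grow true  (x ∷ xs) = x ∷ x ∷ xs
grow false (x ∷ xs) = suc x ∷ xs

-- The shape after the steps 1, …, m.
shape : List ℕ → ℕ → List ℕ
shape I zero    = 1 ∷ []
shape I (suc m) = grow (does (suc m ∈? I)) (shape I m)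

grow-decreasing : ∀ b {xs} → Linked _≥_ xs → Linked _≥_ (grow b xs)
grow-decreasing _     []       = []
grow-decreasing true  [-]      = ≤-refl ∷ [-]
grow-decreasing true  (p ∷ ps) = ≤-refl ∷ p ∷ ps
grow-decreasing false [-]      = [-]
grow-decreasing false (p ∷ ps) = m≤n⇒m≤1+n p ∷ ps

grow-positive : ∀ b {xs} → All (0 <_) xs → All (0 <_) (grow b xs)
grow-positive _     []       = []
grow-positive true  (p ∷ ps) = p ∷ p ∷ ps
grow-positive false (p ∷ ps) = s≤s z≤n ∷ ps

shape-decreasing : ∀ I m → Linked _≥_ (shape I m)
shape-decreasing I zero    = [-]
shape-decreasing I (suc m) = grow-decreasing (does (suc m ∈? I)) (shape-decreasing I m)

shape-positive : ∀ I m → All (0 <_) (shape I m)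
shape-positive I zero    = s≤s z≤n ∷ []
shape-positive I (suc m) = grow-positive (does (suc m ∈? I)) (shape-positive I m)

maxElement : DescentSet → ℕ
maxElement I = foldr _⊔_ 0 (elements I)

λ^ : DescentSet → Partition
λ^ I = record
  { parts      = shape (elements I) (maxElement I)
  ; decreasing = shape-decreasing (elements I) (maxElement I)
  ; positive   = shape-positive (elements I) (maxElement I)
  }

-- Removing the border turns λ₁ ≥ λ₂ ≥ … into λ₂ - 1 ≥ λ₃ - 1 ≥ …
peel : List ℕ → List ℕ
peel (_ ∷ suc (suc y) ∷ ys) = suc y ∷ peel (suc (suc y) ∷ ys)
peel _                      = []

peel-decreasing : ∀ {xs} → Linked _≥_ xs → Linked _≥_ (peel xs)
peel-decreasing []                                       = []
peel-decreasing [-]                                      = []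
peel-decreasing (_∷_ {y = zero} _ _)                     = []
peel-decreasing (_∷_ {y = suc zero} _ _)                 = []
peel-decreasing (_∷_ {y = suc (suc _)} _ [-])            = [-]
peel-decreasing (_∷_ {y = suc (suc _)} _ (_∷_ {y = zero} _ _))              = [-]
peel-decreasing (_∷_ {y = suc (suc _)} _ (_∷_ {y = suc zero} _ _))          = [-]
peel-decreasing (_∷_ {y = suc (suc _)} _ (_∷_ {y = suc (suc _)} (s≤s p) ps)) =
  p ∷ peel-decreasing (s≤s p ∷ ps)

peel-positive : ∀ xs → All (0 <_) (peel xs)
peel-positive []                    = []
peel-positive (_ ∷ [])              = []
peel-positive (_ ∷ zero ∷ _)        = []
peel-positive (_ ∷ suc zero ∷ _)    = []
peel-positive (_ ∷ suc (suc y) ∷ ys) = s≤s z≤n ∷ peel-positive (suc (suc y) ∷ ys)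

inner : Partition → Partition
inner Λ = record
  { parts      = peel (parts Λ)
  ; decreasing = peel-decreasing (decreasing Λ)
  ; positive   = peel-positive (parts Λ)
  }

μ^ : DescentSet → Partition
μ^ I = inner (λ^ I)

------------------------------------------------------------------------
-- λ^ and μ^ have their defining properties

∈-diagram : ∀ xs {i j} → (i , j) ∈ diagram xs ⇔ (1 ≤ j × j ≤ nth xs i)
∈-diagram xs = mk⇔ (f xs) (g xs)
  where
  f : ∀ xs {i j} → (i , j) ∈ diagram xs → 1 ≤ j × j ≤ nth xs i
  f (x ∷ xs) p with ∈-++⁻ (map (λ j → 1 , suc j) (upTo x)) p
  ... | inj₁ q with ∈-map⁻ _ q
  ...   | _ , k∈ , refl = s≤s z≤n , ∈-upTo⁻ k∈
  f (x ∷ xs) p | inj₂ q with ∈-map⁻ below q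
  ...   | (zero , j) , c∈ , refl = contradiction (≤-trans (proj₁ (f xs c∈)) (proj₂ (f xs c∈))) λ ()
  ...   | (suc i , j) , c∈ , refl = f xs c∈

  g : ∀ xs {i j} → 1 ≤ j × j ≤ nth xs i → (i , j) ∈ diagram xs
  g _        {zero}        (1≤j , j≤) = contradiction (≤-trans 1≤j j≤) λ ()
  g []       {suc _}       (1≤j , j≤) = contradiction (≤-trans 1≤j j≤) λ ()
  g (x ∷ xs) {1}           (s≤s _ , j≤) = ∈-++⁺ˡ (∈-map⁺ _ (∈-upTo⁺ j≤))
  g (x ∷ xs) {suc (suc i)} p =
    ∈-++⁺ʳ (map (λ j → 1 , suc j) (upTo x)) (∈-map⁺ below (g xs p))

nth-mono : ∀ {xs} → Linked _≥_ xs → ∀ i → nth xs (suc (suc i)) ≤ nth xs (suc i)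
nth-mono []       i       = z≤n
nth-mono [-]      i       = z≤n
nth-mono (p ∷ ps) zero    = p
nth-mono (p ∷ ps) (suc i) = nth-mono ps i

Rim : List ℕ → Cell → Set
Rim xs (i , j) = 1 ≤ j × j ≤ nth xs i × nth xs (suc i) ≤ j

∈-closed : ∀ Λ c → c ∈ 𝔻 Λ → diag c ∈ 𝔻 Λ → right c ∈ 𝔻 Λ × below c ∈ 𝔻 Λ
∈-closed Λ (zero , j) p q with to (∈-diagram (parts Λ)) p
... | 1≤j , j≤ = contradiction (≤-trans 1≤j j≤) λ ()
∈-closed Λ (suc i , j) p q with to (∈-diagram (parts Λ)) p | to (∈-diagram (parts Λ)) q
... | 1≤j , _ | 1≤1+j , 1+j≤ =
  from (∈-diagram (parts Λ)) (1≤1+j , ≤-trans 1+j≤ (nth-mono (decreasing Λ) i)) ,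
  from (∈-diagram (parts Λ)) (1≤j , ≤-trans (n≤1+n j) 1+j≤)

border⇔ : ∀ Λ c → Border Λ c ⇔ (c ∈ 𝔻 Λ × diag c ∉ 𝔻 Λ)
border⇔ Λ c = mk⇔ f g
  where
  f : Border Λ c → c ∈ 𝔻 Λ × diag c ∉ 𝔻 Λ
  f (c∈ , <3) = c∈ , λ d∈ → <-irrefl
    (cong length (filter-all (_∈ᶜ? 𝔻 Λ)
      (proj₁ (∈-closed Λ c c∈ d∈) ∷ proj₂ (∈-closed Λ c c∈ d∈) ∷ d∈ ∷ [])))
    <3
  g : c ∈ 𝔻 Λ × diag c ∉ 𝔻 Λ → Border Λ c
  g (c∈ , d∉) = c∈ , filter-notAll (_∈ᶜ? 𝔻 Λ) _ (there (there (here d∉)))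

border⇔Rim : ∀ Λ c → Border Λ c ⇔ Rim (parts Λ) c
border⇔Rim Λ (i , j) = mk⇔ f g
  where
  f : Border Λ (i , j) → Rim (parts Λ) (i , j)
  f b with to (border⇔ Λ (i , j)) b
  ... | c∈ , d∉ with to (∈-diagram (parts Λ)) c∈
  ...   | 1≤j , j≤ = 1≤j , j≤ , ≮⇒≥ λ lt → d∉ (from (∈-diagram (parts Λ)) (s≤s z≤n , lt))
  g : Rim (parts Λ) (i , j) → Border Λ (i , j)
  g (1≤j , j≤ , ≤j) = from (border⇔ Λ (i , j))
    ( from (∈-diagram (parts Λ)) (1≤j , j≤)
    , λ d∈ → <-irrefl refl (≤-trans (proj₂ (to (∈-diagram (parts Λ)) d∈)) ≤j))

nth-≤1 : ∀ {x xs} → Linked _≥_ (x ∷ xs) → x ≤ 1 → ∀ i → 0 ≡ nth (x ∷ xs) (suc i) ∸ 1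
nth-≤1 _        p zero    = sym (m≤n⇒m∸n≡0 p)
nth-≤1 [-]      p (suc i) = refl
nth-≤1 (q ∷ qs) p (suc i) = nth-≤1 qs (≤-trans q p) i

nth-peel : ∀ {xs} → Linked _≥_ xs → ∀ i → nth (peel xs) (suc i) ≡ nth xs (suc (suc i)) ∸ 1
nth-peel []                           i       = refl
nth-peel [-]                          i       = refl
nth-peel (_∷_ {y = zero} _ ps)        i       = nth-≤1 ps z≤n i
nth-peel (_∷_ {y = suc zero} _ ps)    i       = nth-≤1 ps (s≤s z≤n) i
nth-peel (_∷_ {y = suc (suc y)} _ ps) zero    = refl
nth-peel (_∷_ {y = suc (suc y)} _ ps) (suc i) = nth-peel ps i

inner-spec : ∀ Λ c → c ∈ 𝔻 (inner Λ) ⇔ (c ∈ 𝔻 Λ × ¬ Border Λ c)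
inner-spec Λ (i , j) = mk⇔ f g
  where
  xs = parts Λ
  f : ∀ {i} → (i , j) ∈ 𝔻 (inner Λ) → (i , j) ∈ 𝔻 Λ × ¬ Border Λ (i , j)
  f {i} c∈ with to (∈-diagram (peel xs)) c∈
  f {zero}  c∈ | 1≤j , j≤ = contradiction (≤-trans 1≤j j≤) λ ()
  f {suc i} c∈ | 1≤j , j≤ =
    from (∈-diagram xs) (1≤j , ≤-trans (<⇒≤ lt) (nth-mono (decreasing Λ) i)) ,
    λ b → <-irrefl refl (≤-trans lt (proj₂ (proj₂ (to (border⇔Rim Λ (suc i , j)) b))))
    where
    j≤′ : j ≤ nth xs (suc (suc i)) ∸ 1
    j≤′ = subst (j ≤_) (nth-peel (decreasing Λ) i) j≤
    lt : j < nth xs (suc (suc i))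
    lt with nth xs (suc (suc i)) | j≤′
    ... | zero  | q = contradiction (≤-trans 1≤j q) λ ()
    ... | suc _ | q = s≤s q

  g : ∀ {i} → (i , j) ∈ 𝔻 Λ × ¬ Border Λ (i , j) → (i , j) ∈ 𝔻 (inner Λ)
  g {i} (c∈ , ¬b) with to (∈-diagram xs) c∈
  g {zero}  (c∈ , ¬b) | 1≤j , j≤ = contradiction (≤-trans 1≤j j≤) λ ()
  g {suc i} (c∈ , ¬b) | 1≤j , j≤ = from (∈-diagram (peel xs))
    (1≤j , subst (j ≤_) (sym (nth-peel (decreasing Λ) i)) (∸-monoˡ-≤ 1 lt))
    where
    lt : j < nth xs (suc (suc i))
    lt = ≰⇒> λ q → ¬b (from (border⇔Rim Λ (suc i , j)) (1≤j , j≤ , q))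

-- The k-th cell of the ribbon after the steps 1, …, m.
place : List ℕ → ℕ → ℕ → Cell
place I zero    k = 1 , 1
place I (suc m) k with suc m ∈? I | k ≤? suc m
... | yes _ | yes _ = below (place I m k)
... | yes _ | no _  = place I m (suc m)
... | no _  | yes _ = place I m k
... | no _  | no _  = right (place I m (suc m))

place-up : ∀ I m {k} → suc m ∈ I → k ≤ suc m → place I (suc m) k ≡ below (place I m k)
place-up I m {k} m∈ k≤ with suc m ∈? I | k ≤? suc m
... | yes _  | yes _  = refl
... | yes _  | no k≰  = contradiction k≤ k≰
... | no m∉  | _      = contradiction m∈ m∉

place-up-new : ∀ I m → suc m ∈ I → place I (suc m) (suc (suc m)) ≡ place I m (suc m)
place-up-new I m m∈ with suc m ∈? I | suc (suc m) ≤? suc m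
... | _     | yes p = contradiction p (<-irrefl refl)
... | yes _ | no _  = refl
... | no m∉ | no _  = contradiction m∈ m∉

place-right : ∀ I m {k} → suc m ∉ I → k ≤ suc m → place I (suc m) k ≡ place I m k
place-right I m {k} m∉ k≤ with suc m ∈? I | k ≤? suc m
... | no _   | yes _  = refl
... | no _   | no k≰  = contradiction k≤ k≰
... | yes m∈ | _      = contradiction m∈ m∉

place-right-new : ∀ I m → suc m ∉ I →
                  place I (suc m) (suc (suc m)) ≡ right (place I m (suc m))
place-right-new I m m∉ with suc m ∈? I | suc (suc m) ≤? suc m
... | _      | yes p = contradiction p (<-irrefl refl)
... | no _   | no _  = refl
... | yes m∈ | no _  = contradiction m∈ m∉

Rim-up : ∀ {x xs} → 1 ≤ x → ∀ {c} →
         Rim (x ∷ x ∷ xs) c ⇔ (c ≡ (1 , x) ⊎ (∃[ d ] Rim (x ∷ xs) d × c ≡ below d))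
Rim-up {x} {xs} 1≤x = mk⇔ f g
  where
  f : ∀ {c} → Rim (x ∷ x ∷ xs) c → c ≡ (1 , x) ⊎ (∃[ d ] Rim (x ∷ xs) d × c ≡ below d)
  f {zero , j}        (1≤j , j≤ , _)  = contradiction (≤-trans 1≤j j≤) λ ()
  f {1 , j}           (_ , j≤x , x≤j) = inj₁ (cong (1 ,_) (≤-antisym j≤x x≤j))
  f {suc (suc i) , j} r               = inj₂ ((suc i , j) , r , refl)
  g : ∀ {c} → c ≡ (1 , x) ⊎ (∃[ d ] Rim (x ∷ xs) d × c ≡ below d) → Rim (x ∷ x ∷ xs) c
  g (inj₁ refl)                                  = 1≤x , ≤-refl , ≤-refl
  g (inj₂ ((zero , j) , (1≤j , j≤ , _) , refl))  = contradiction (≤-trans 1≤j j≤) λ ()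
  g (inj₂ ((suc i , j) , r , refl))              = r

Rim-right : ∀ {x xs} → Linked _≥_ (x ∷ xs) → ∀ {c} →
            Rim (suc x ∷ xs) c ⇔ (c ≡ (1 , suc x) ⊎ Rim (x ∷ xs) c)
Rim-right {x} {xs} dec = mk⇔ f g
  where
  f : ∀ {c} → Rim (suc x ∷ xs) c → c ≡ (1 , suc x) ⊎ Rim (x ∷ xs) c
  f {zero , j}        (1≤j , j≤ , _)    = contradiction (≤-trans 1≤j j≤) λ ()
  f {1 , j}           (1≤j , j≤ , ≤j) with m≤n⇒m<n∨m≡n j≤
  ... | inj₁ (s≤s j≤x) = inj₂ (1≤j , j≤x , ≤j)
  ... | inj₂ refl      = inj₁ refl
  f {suc (suc i) , j} r                 = inj₂ r
  g : ∀ {c} → c ≡ (1 , suc x) ⊎ Rim (x ∷ xs) c → Rim (suc x ∷ xs) c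
  g                   (inj₁ refl)            = s≤s z≤n , ≤-refl , m≤n⇒m≤1+n (nth-mono dec 0)
  g {zero , j}        (inj₂ (1≤j , j≤ , _))  = contradiction (≤-trans 1≤j j≤) λ ()
  g {1 , j}           (inj₂ (1≤j , j≤ , ≤j)) = 1≤j , m≤n⇒m≤1+n j≤ , ≤j
  g {suc (suc i) , j} (inj₂ r)               = r

Placed : List ℕ → ℕ → Cell → Set
Placed I m c = ∃[ k ] 1 ≤ k × k ≤ suc m × c ≡ place I m k

Step : List ℕ → ℕ → ℕ → Set
Step I m k = (k ∈ I × place I m k ≡ below (place I m (suc k)))
           ⊎ (k ∉ I × place I m (suc k) ≡ right (place I m k))

Placed-up : ∀ {I m c} → suc m ∈ I →
            Placed I (suc m) c ⇔ (c ≡ place I m (suc m) ⊎ (∃[ d ] Placed I m d × c ≡ below d))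
Placed-up {I} {m} m∈ = mk⇔ f g
  where
  f : ∀ {c} → Placed I (suc m) c → c ≡ place I m (suc m) ⊎ (∃[ d ] Placed I m d × c ≡ below d)
  f (k , 1≤k , k≤ , refl) with m≤n⇒m<n∨m≡n k≤
  ... | inj₁ (s≤s k≤m) = inj₂ (_ , (k , 1≤k , k≤m , refl) , place-up I m m∈ k≤m)
  ... | inj₂ refl      = inj₁ (place-up-new I m m∈)
  g : ∀ {c} → c ≡ place I m (suc m) ⊎ (∃[ d ] Placed I m d × c ≡ below d) → Placed I (suc m) c
  g (inj₁ refl) = suc (suc m) , s≤s z≤n , ≤-refl , sym (place-up-new I m m∈)
  g (inj₂ (_ , (k , 1≤k , k≤ , refl) , refl)) =
    k , 1≤k , m≤n⇒m≤1+n k≤ , sym (place-up I m m∈ k≤)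

Placed-right : ∀ {I m c} → suc m ∉ I →
               Placed I (suc m) c ⇔ (c ≡ right (place I m (suc m)) ⊎ Placed I m c)
Placed-right {I} {m} m∉ = mk⇔ f g
  where
  f : ∀ {c} → Placed I (suc m) c → c ≡ right (place I m (suc m)) ⊎ Placed I m c
  f (k , 1≤k , k≤ , refl) with m≤n⇒m<n∨m≡n k≤
  ... | inj₁ (s≤s k≤m) = inj₂ (k , 1≤k , k≤m , place-right I m m∉ k≤m)
  ... | inj₂ refl      = inj₁ (place-right-new I m m∉)
  g : ∀ {c} → c ≡ right (place I m (suc m)) ⊎ Placed I m c → Placed I (suc m) c
  g (inj₁ refl) = suc (suc m) , s≤s z≤n , ≤-refl , sym (place-right-new I m m∉)
  g (inj₂ (k , 1≤k , k≤ , refl)) = k , 1≤k , m≤n⇒m≤1+n k≤ , sym (place-right I m m∉ k≤)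

record Laid (I : List ℕ) (m : ℕ) : Set where
  field
    x      : ℕ
    xs     : List ℕ
    shape≡ : shape I m ≡ x ∷ xs
    1≤x    : 1 ≤ x
    dec    : Linked _≥_ (x ∷ xs)
    last   : place I m (suc m) ≡ (1 , x)
    rim    : ∀ c → Rim (x ∷ xs) c ⇔ Placed I m c
    steps  : ∀ k → 1 ≤ k → k ≤ m → Step I m k

laid : ∀ I m → Laid I m
laid I zero = record
  { x = 1 ; xs = [] ; shape≡ = refl ; 1≤x = ≤-refl ; dec = [-] ; last = refl
  ; rim = λ c → mk⇔ f λ { (_ , _ , _ , refl) → ≤-refl , ≤-refl , z≤n }
  ; steps = λ { _ (s≤s _) () } }
  where
  f : ∀ {c} → Rim (1 ∷ []) c → Placed I 0 c
  f {zero , j}        (1≤j , j≤ , _) = contradiction (≤-trans 1≤j j≤) λ ()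
  f {1 , j}           (1≤j , j≤ , _) = 1 , ≤-refl , ≤-refl , cong (1 ,_) (≤-antisym j≤ 1≤j)
  f {suc (suc _) , j} (1≤j , j≤ , _) = contradiction (≤-trans 1≤j j≤) λ ()
laid I (suc m) with suc m ∈? I
... | yes m∈ = record
  { x = x ; xs = x ∷ xs ; shape≡ = shape-up ; 1≤x = 1≤x ; dec = ≤-refl ∷ dec
  ; last = trans (place-up-new I m m∈) last
  ; rim = λ c → mk⇔ (f ∘ to (Rim-up 1≤x)) (from (Rim-up 1≤x) ∘ g ∘ to (Placed-up m∈))
  ; steps = steps′ }
  where
  open Laid (laid I m)
  shape-up : shape I (suc m) ≡ x ∷ x ∷ xs
  shape-up rewrite dec-true (suc m ∈? I) m∈ | shape≡ = refl
  f : ∀ {c} → c ≡ (1 , x) ⊎ (∃[ d ] Rim (x ∷ xs) d × c ≡ below d) → Placed I (suc m) c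
  f (inj₁ e)           = from (Placed-up m∈) (inj₁ (trans e (sym last)))
  f (inj₂ (d , r , e)) = from (Placed-up m∈) (inj₂ (d , to (rim d) r , e))
  g : ∀ {c} → c ≡ place I m (suc m) ⊎ (∃[ d ] Placed I m d × c ≡ below d) →
      c ≡ (1 , x) ⊎ (∃[ d ] Rim (x ∷ xs) d × c ≡ below d)
  g (inj₁ e)           = inj₁ (trans e last)
  g (inj₂ (d , p , e)) = inj₂ (d , from (rim d) p , e)
  steps′ : ∀ k → 1 ≤ k → k ≤ suc m → Step I (suc m) k
  steps′ k 1≤k k≤ with m≤n⇒m<n∨m≡n k≤
  ... | inj₂ refl = inj₁ (m∈ , trans (place-up I m m∈ ≤-refl)
                                     (cong below (sym (place-up-new I m m∈))))
  ... | inj₁ (s≤s k≤m) with steps k 1≤k k≤m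
  ...   | inj₁ (k∈ , e) = inj₁ (k∈ , trans (place-up I m m∈ k≤)
                                     (cong below (trans e (sym (place-up I m m∈ (s≤s k≤m))))))
  ...   | inj₂ (k∉ , e) = inj₂ (k∉ , trans (place-up I m m∈ (s≤s k≤m))
                                     (trans (cong below e) (cong right (sym (place-up I m m∈ k≤)))))
... | no m∉ = record
  { x = suc x ; xs = xs ; shape≡ = shape-right ; 1≤x = s≤s z≤n ; dec = grow-decreasing false dec
  ; last = trans (place-right-new I m m∉) (cong right last)
  ; rim = λ c → mk⇔ (f ∘ to (Rim-right dec)) (from (Rim-right dec) ∘ g ∘ to (Placed-right m∉))
  ; steps = steps′ }
  where
  open Laid (laid I m)
  shape-right : shape I (suc m) ≡ suc x ∷ xs
  shape-right rewrite dec-false (suc m ∈? I) m∉ | shape≡ = refl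
  f : ∀ {c} → c ≡ (1 , suc x) ⊎ Rim (x ∷ xs) c → Placed I (suc m) c
  f (inj₁ e) = from (Placed-right m∉) (inj₁ (trans e (cong right (sym last))))
  f (inj₂ r) = from (Placed-right m∉) (inj₂ (to (rim _) r))
  g : ∀ {c} → c ≡ right (place I m (suc m)) ⊎ Placed I m c → c ≡ (1 , suc x) ⊎ Rim (x ∷ xs) c
  g (inj₁ e) = inj₁ (trans e (cong right last))
  g (inj₂ p) = inj₂ (from (rim _) p)
  steps′ : ∀ k → 1 ≤ k → k ≤ suc m → Step I (suc m) k
  steps′ k 1≤k k≤ with m≤n⇒m<n∨m≡n k≤
  ... | inj₂ refl = inj₂ (m∉ , trans (place-right-new I m m∉)
                                     (cong right (sym (place-right I m m∉ ≤-refl))))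
  ... | inj₁ (s≤s k≤m) with steps k 1≤k k≤m
  ...   | inj₁ (k∈ , e) = inj₁ (k∈ , trans (place-right I m m∉ k≤)
                                     (trans e (cong below (sym (place-right I m m∉ (s≤s k≤m))))))
  ...   | inj₂ (k∉ , e) = inj₂ (k∉ , trans (place-right I m m∉ (s≤s k≤m))
                                     (trans e (cong right (sym (place-right I m m∉ k≤)))))

≤-max : ∀ {k} xs → k ∈ xs → k ≤ foldr _⊔_ 0 xs
≤-max (x ∷ xs) (here refl) = m≤m⊔n x _
≤-max (x ∷ xs) (there p)   = ≤-trans (≤-max xs p) (m≤n⊔m x _)

max-∈ : ∀ xs → xs ≢ [] → All (0 <_) xs → foldr _⊔_ 0 xs ∈ xs
max-∈ []       ne _  = contradiction refl ne
max-∈ (x ∷ xs) _  ps with foldr-selective ⊔-sel 0 (x ∷ xs) | ps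
... | inj₂ q | _     = q
... | inj₁ q | p ∷ _ = contradiction (≤-trans p (≤-trans (m≤m⊔n x _) (≤-reflexive q))) λ ()

λ^-spec : ∀ I → IsRibbonShape I (λ^ I)
λ^-spec I = rows≡ (maxElement I) (max-∈ E (DescentSet.nonempty I) (DescentSet.positive I)) , record
  { n        = suc M
  ; cell     = place E M
  ; border   = λ c → mk⇔ (to (rim c) ∘ subst (λ zs → Rim zs c) shape≡ ∘ to (border⇔Rim (λ^ I) c))
                         (from (border⇔Rim (λ^ I) c) ∘ subst (λ zs → Rim zs c) (sym shape≡) ∘ from (rim c))
  ; ribbon   = λ { k 1≤k (s≤s k≤M) → ribbon′ (steps k 1≤k k≤M) }
  ; descents = λ k → mk⇔ (f k) (g k)
  }
  where
  E = elements I
  M = maxElement I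
  open Laid (laid E M)

  rows≡ : ∀ m → m ∈ E → nth (shape E m) 1 ≡ nth (shape E m) 2
  rows≡ zero    m∈ = contradiction (All.lookup (DescentSet.positive I) m∈) λ ()
  rows≡ (suc m) m∈ rewrite dec-true (suc m ∈? E) m∈ with shape E m
  ... | []    = refl
  ... | _ ∷ _ = refl

  ribbon′ : ∀ {k} → Step E M k →
            place E M (suc k) ≡ right (place E M k) ⊎ place E M k ≡ below (place E M (suc k))
  ribbon′ (inj₁ (_ , e)) = inj₂ e
  ribbon′ (inj₂ (_ , e)) = inj₁ e

  f : ∀ k → k ∈ E → 1 ≤ k × k < suc M × place E M k ≡ below (place E M (suc k))
  f k k∈ with All.lookup (DescentSet.positive I) k∈ | ≤-max E k∈
  ... | 1≤k | k≤M with steps k 1≤k k≤M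
  ...   | inj₁ (_ , e)  = 1≤k , s≤s k≤M , e
  ...   | inj₂ (k∉ , _) = contradiction k∈ k∉

  g : ∀ k → 1 ≤ k × k < suc M × place E M k ≡ below (place E M (suc k)) → k ∈ E
  g k (1≤k , s≤s k≤M , e) with steps k 1≤k k≤M
  ... | inj₁ (k∈ , _) = k∈
  ... | inj₂ (_ , e′) = contradiction (cong row (trans e (cong below e′))) (1+n≢n ∘ sym)

μ^-spec : ∀ I c → c ∈ 𝔻 (μ^ I) ⇔ (c ∈ 𝔻 (λ^ I) × ¬ Border (λ^ I) c)
μ^-spec I = inner-spec (λ^ I)

------------------------------------------------------------------------
-- Naruse–Newton coefficients

s : DescentSet → ℕ
s I = part (λ^ I) 1 ∸ 1

firstRow : List Cell → ℕ
firstRow D = length (filter (λ c → row c ≟ 1) D)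

hookProduct : Partition → List Cell → ℕ
hookProduct Λ D = product (map (hook Λ) (filter (λ c → ¬? (row c ≟ 1)) D))

-- C I j is C_j(I), meaningful for j ≤ s I.
C : DescentSet → ℕ → ℕ
C I j = sum (map (hookProduct (λ^ I))
                 (filter (λ D → firstRow D + j ≟ s I) (𝔼 (λ^ I) (μ^ I))))

-- I_a = {1, 3, …, 2a + 1}
odds : ℕ → DescentSet
odds a = record
  { elements = map (λ k → 2 * k + 1) (upTo (suc a))
  ; nonempty = λ ()
  ; positive = All.map⁺ {f = λ k → 2 * k + 1} (All.universal (λ k → m≤n+m 1 (2 * k)) (upTo (suc a)))
  }

------------------------------------------------------------------------
-- Polynomials over ℚ

-- Coefficients in ascending order; trailing zeros are allowed, so equality is
-- _≈_ below.
Polynomial : Set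
Polynomial = List ℚ

coeff : Polynomial → ℕ → ℚ
coeff []      _       = 0ℚ
coeff (c ∷ _) zero    = c
coeff (_ ∷ p) (suc k) = coeff p k

infix 4 _≈_
_≈_ : Polynomial → Polynomial → Set
p ≈ q = ∀ k → coeff p k ≡ coeff q k

DegreeAtMost : ℕ → Polynomial → Set
DegreeAtMost i p = ∀ k → i < k → coeff p k ≡ 0ℚ

eval : Polynomial → ℚ → ℚ
eval p x = foldr (λ c v → c ℚ.+ x ℚ.* v) 0ℚ p

-- The complement of an excited diagram of λ^I/μ^I is a lattice path.  For I = I_a
-- the part of the path below the first row runs through a staircase, where a cell on
-- the ℓ-th antidiagonal from the border (ℓ ≥ 0) has hook length 2ℓ + 1.  Conditioning
-- on the last step of the path, and cancelling the first-row products against C_a,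
-- one finds that the ratios Q_i(a) = C_{a-i}(I_a) / C_a(I_a) satisfy Q_0 = 1 and
--   (2(a - i) + 1) Q_i(a) = (2a + 1) Q_i(a - 1) + Q_{i-1}(a),   Q_i(i - 1) := 0.
-- The operator p ↦ (2(a - i) + 1) p(a) - (2a + 1) p(a - 1) is diagonal in the basis
-- b_k = (2a + 1)(2a - 1) ⋯ (2a - 2k + 3), with eigenvalues 2(k - i).  So the recurrence
-- is solved by polynomials of degree at most i, up to a multiple of b_i; that
-- multiple is fixed by the root at i - 1, as b_i(i - 1) ≠ 0.

module Submission where

open import Defs
open import Data.Nat using (ℕ; _≤_; _∸_; NonZero)
open import Data.Integer using (+_)
open import Data.Rational using (_/_)
open import Data.Product using (Σ; _×_; ∃!)
open import Relation.Binary.PropositionalEquality using (_≡_)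

-- Excited diagrams are given by reachability, while the recurrence looks at one step of the path at
-- a time. A path is therefore encoded by a weakly decreasing sequence, its profile, in which an
-- excitation is the decrement of a single entry. Entry 1 counts the first-row cells, so
-- `pathSum a i` is C_{a-i}(I_a).
--
-- The recurrence is kept free of division. Weights run over the cells off the path, so multiplying
-- by the hook of the entry cell either releases that cell to a path entering one column further
-- left, or completes a whole row of the staircase. The product `rowWeight` of such a row does not
-- depend on i, and for i = 0 it is the only term; this is why the products cancel in the ratio to
-- C_a. The convention Q_i(i - 1) := 0 records that nothing lies below the last cell of the first
-- staircase row.
--
-- On the polynomial side, Q_{i-1} has degree at most i - 1, so only nonzero eigenvalues are
-- inverted. For uniqueness, two candidates agree at all integers from i on, and a polynomial with
-- infinitely many zeros vanishes.

module RationalPolynomials where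

  import Data.Integer as ℤ
  import Data.Integer.Properties as ℤ
  open import Data.Integer.Tactic.RingSolver using () renaming (solve-∀ to ℤ-solve-∀)
  open import Data.List using (List; []; _∷_; length; map)
  open import Data.List.Properties using (length-map)
  open import Data.Nat as ℕ using (zero; suc; z≤n; s≤s)
  import Data.Nat.Properties as ℕ
  open import Data.Nat.Tactic.RingSolver using () renaming (solve-∀ to ℕ-solve-∀)
  open import Data.Product using (_,_; proj₂)
  open import Data.Rational using (ℚ; 0ℚ; 1ℚ; ½; _+_; _*_; -_; toℚᵘ)
  open import Data.Rational.Properties
    using (+-*-commutativeRing; _≟_; toℚᵘ-injective; toℚᵘ-fromℚᵘ; toℚᵘ-homo-+; toℚᵘ-homo-*;
           *-assoc; *-comm; *-identityʳ; *-identityˡ; *-zeroˡ; *-zeroʳ; +-identityʳ; +-identityˡ)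
  import Data.Rational.Unnormalised as ℚᵘ
  import Data.Rational.Unnormalised.Properties as ℚᵘ
  open import Data.Sum using (_⊎_; inj₁; inj₂)
  open import Relation.Binary.PropositionalEquality
    using (refl; sym; trans; cong; cong₂; subst; module ≡-Reasoning)
  open import Relation.Nullary.Decidable using (dec⇒maybe)
  open import Tactic.RingSolver using (solve-∀)
  import Tactic.RingSolver.Core.AlmostCommutativeRing as ACR
  open ≡-Reasoning

  -- Natural numbers and their quotients inside the rationals

  ℚ-ring : ACR.AlmostCommutativeRing _ _
  ℚ-ring = ACR.fromCommutativeRing +-*-commutativeRing λ x → dec⇒maybe (0ℚ ≟ x)

  -- Opaque, so that the gcd computations inside _/_ are never unfolded.
  abstract
    ι : ℕ → ℚ
    ι n = + n / 1

    ι-def : ∀ n → ι n ≡ + n / 1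
    ι-def n = refl

    ι-0 : ι 0 ≡ 0ℚ
    ι-0 = refl

    ι-1 : ι 1 ≡ 1ℚ
    ι-1 = refl

    toℚᵘ-/ : ∀ m n .{{_ : NonZero n}} → toℚᵘ (+ m / n) ℚᵘ.≃ (+ m ℚᵘ./ n)
    toℚᵘ-/ m (suc n) = toℚᵘ-fromℚᵘ (ℚᵘ.mkℚᵘ (+ m) n)

    ι-+ : ∀ m n → ι (m ℕ.+ n) ≡ ι m + ι n
    ι-+ m n = toℚᵘ-injective
      (ℚᵘ.≃-trans (toℚᵘ-/ (m ℕ.+ n) 1)
      (ℚᵘ.≃-trans (ℚᵘ.*≡* (lemma (+ m) (+ n)))
      (ℚᵘ.≃-sym (ℚᵘ.≃-trans (toℚᵘ-homo-+ (ι m) (ι n)) (ℚᵘ.+-cong (toℚᵘ-/ m 1) (toℚᵘ-/ n 1))))))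
      where
      lemma : ∀ x y → (x ℤ.+ y) ℤ.* + 1 ≡ (x ℤ.* + 1 ℤ.+ y ℤ.* + 1) ℤ.* + 1
      lemma = ℤ-solve-∀

    -- Transferred to unnormalised rationals, where equality is cross-multiplication and no gcd
    -- occurs.
    /-*-/ : ∀ m n k l r s .{{_ : NonZero n}} .{{_ : NonZero l}} .{{_ : NonZero s}} →
            m ℕ.* k ℕ.* s ≡ r ℕ.* (n ℕ.* l) → (+ m / n) * (+ k / l) ≡ + r / s
    /-*-/ m n@(suc _) k l@(suc _) r s@(suc _) e = toℚᵘ-injective
      (ℚᵘ.≃-trans (toℚᵘ-homo-* (+ m / n) (+ k / l))
      (ℚᵘ.≃-trans (ℚᵘ.*-cong (toℚᵘ-/ m n) (toℚᵘ-/ k l))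
      (ℚᵘ.≃-trans (ℚᵘ.*≡* (begin
        (+ m ℤ.* + k) ℤ.* + s  ≡⟨ cong (ℤ._* + s) (ℤ.pos-* m k) ⟨
        + (m ℕ.* k) ℤ.* + s    ≡⟨ ℤ.pos-* (m ℕ.* k) s ⟨
        + (m ℕ.* k ℕ.* s)      ≡⟨ cong +_ e ⟩
        + (r ℕ.* (n ℕ.* l))    ≡⟨ ℤ.pos-* r (n ℕ.* l) ⟩
        + r ℤ.* + (n ℕ.* l)    ∎)) (ℚᵘ.≃-sym (toℚᵘ-/ r s)))))

    ι-* : ∀ m n → ι (m ℕ.* n) ≡ ι m * ι n
    ι-* m n = sym (/-*-/ m 1 n 1 (m ℕ.* n) 1 refl)

    /-*-ι : ∀ m n .{{_ : NonZero n}} → (+ m / n) * ι n ≡ ι m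
    /-*-ι m n = /-*-/ m n n 1 m 1 (lemma m n)
      where
      lemma : ∀ m n → m ℕ.* n ℕ.* 1 ≡ m ℕ.* (n ℕ.* 1)
      lemma = ℕ-solve-∀

  abstract
    recip : ∀ n .{{_ : NonZero n}} → ℚ
    recip n = + 1 / n

    recip-* : ∀ n .{{_ : NonZero n}} → recip n * ι n ≡ 1ℚ
    recip-* n = trans (/-*-ι 1 n) ι-1

  ι-suc : ∀ n → ι (suc n) ≡ 1ℚ + ι n
  ι-suc n = trans (ι-+ 1 n) (cong (_+ ι n) ι-1)

  ι-*-cancelʳ : ∀ {x y} n .{{_ : NonZero n}} → x * ι n ≡ y * ι n → x ≡ y
  ι-*-cancelʳ {x} {y} n e = trans (sym (undo x)) (trans (cong (_* recip n) e) (undo y))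
    where
    undo : ∀ z → z * ι n * recip n ≡ z
    undo z = trans (*-assoc z (ι n) (recip n))
      (trans (cong (z *_) (trans (*-comm (ι n) (recip n)) (recip-* n))) (*-identityʳ z))

  /-unique : ∀ {x m} n .{{_ : NonZero n}} → x * ι n ≡ ι m → x ≡ + m / n
  /-unique {x} {m} n e = ι-*-cancelʳ n (trans e (sym (/-*-ι m n)))

  -- Arithmetic of coefficient lists

  infixl 6 _⊕_
  infixl 7 _⊙_

  _⊕_ : Polynomial → Polynomial → Polynomial
  []      ⊕ q       = q
  (c ∷ p) ⊕ []      = c ∷ p
  (c ∷ p) ⊕ (d ∷ q) = c + d ∷ p ⊕ q

  _⊙_ : ℚ → Polynomial → Polynomial
  c ⊙ p = map (c *_) p

  affine-* : ℚ → ℚ → Polynomial → Polynomial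
  affine-* u v p = u ⊙ p ⊕ (0ℚ ∷ v ⊙ p)

  eval-⊕ : ∀ p q x → eval (p ⊕ q) x ≡ eval p x + eval q x
  eval-⊕ []      q       x = sym (+-identityˡ _)
  eval-⊕ (c ∷ p) []      x = sym (+-identityʳ _)
  eval-⊕ (c ∷ p) (d ∷ q) x rewrite eval-⊕ p q x = lemma c d x (eval p x) (eval q x)
    where
    lemma : ∀ c d x a b → c + d + x * (a + b) ≡ c + x * a + (d + x * b)
    lemma = solve-∀ ℚ-ring

  eval-⊙ : ∀ c p x → eval (c ⊙ p) x ≡ c * eval p x
  eval-⊙ c []      x = sym (*-zeroʳ c)
  eval-⊙ c (d ∷ p) x rewrite eval-⊙ c p x = lemma c d x (eval p x)
    where
    lemma : ∀ c d x a → c * d + x * (c * a) ≡ c * (d + x * a)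
    lemma = solve-∀ ℚ-ring

  eval-affine-* : ∀ u v p x → eval (affine-* u v p) x ≡ (u + v * x) * eval p x
  eval-affine-* u v p x
    rewrite eval-⊕ (u ⊙ p) (0ℚ ∷ v ⊙ p) x | eval-⊙ u p x | eval-⊙ v p x = lemma u v x (eval p x)
    where
    lemma : ∀ u v x a → u * a + (0ℚ + x * (v * a)) ≡ (u + v * x) * a
    lemma = solve-∀ ℚ-ring

  coeff-⊕ : ∀ p q k → coeff (p ⊕ q) k ≡ coeff p k + coeff q k
  coeff-⊕ []      q       k       = sym (+-identityˡ _)
  coeff-⊕ (c ∷ p) []      k       = sym (+-identityʳ _)
  coeff-⊕ (c ∷ p) (d ∷ q) zero    = refl
  coeff-⊕ (c ∷ p) (d ∷ q) (suc k) = coeff-⊕ p q k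

  coeff-⊙ : ∀ c p k → coeff (c ⊙ p) k ≡ c * coeff p k
  coeff-⊙ c []      k       = sym (*-zeroʳ c)
  coeff-⊙ c (d ∷ p) zero    = refl
  coeff-⊙ c (d ∷ p) (suc k) = coeff-⊙ c p k

  length-⊕ : ∀ p q {n} → length p ≤ n → length q ≤ n → length (p ⊕ q) ≤ n
  length-⊕ []      q       p≤ q≤ = q≤
  length-⊕ (c ∷ p) []      p≤ q≤ = p≤
  length-⊕ (c ∷ p) (d ∷ q) (s≤s p≤) (s≤s q≤) = s≤s (length-⊕ p q p≤ q≤)

  length-⊙ : ∀ c p {n} → length p ≤ n → length (c ⊙ p) ≤ n
  length-⊙ c p = subst (_≤ _) (sym (length-map (c *_) p))

  length⇒degree : ∀ p {i} → length p ≤ suc i → DegreeAtMost i p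
  length⇒degree []      p≤       k       i<k       = refl
  length⇒degree (c ∷ p) (s≤s p≤) (suc k) (s≤s i≤k) = beyond p (ℕ.≤-trans p≤ i≤k)
    where
    beyond : ∀ p {k} → length p ≤ k → coeff p k ≡ 0ℚ
    beyond []      p≤       = refl
    beyond (c ∷ p) (s≤s p≤) = beyond p p≤

  -- Division by a linear factor and uniqueness of interpolation

  -- Synthetic division by t - r.
  quotient : ℚ → Polynomial → Polynomial
  quotient r []          = []
  quotient r (_ ∷ [])    = []
  quotient r (_ ∷ p@(_ ∷ _)) = eval p r ∷ quotient r p

  eval-quotient : ∀ r p x → eval p x ≡ (x + - r) * eval (quotient r p) x + eval p r
  eval-quotient r []       x = lemma r x
    where
    lemma : ∀ r x → 0ℚ ≡ (x + - r) * 0ℚ + 0ℚ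
    lemma = solve-∀ ℚ-ring
  eval-quotient r (c ∷ []) x = lemma c r x
    where
    lemma : ∀ c r x → c + x * 0ℚ ≡ (x + - r) * 0ℚ + (c + r * 0ℚ)
    lemma = solve-∀ ℚ-ring
  eval-quotient r (c ∷ p@(_ ∷ _)) x = begin
    c + x * eval p x                                                  ≡⟨ cong (λ v → c + x * v) (eval-quotient r p x) ⟩
    c + x * ((x + - r) * eval (quotient r p) x + eval p r)            ≡⟨ lemma c r x _ _ ⟩
    (x + - r) * (eval p r + x * eval (quotient r p) x) + (c + r * eval p r) ∎
    where
    lemma : ∀ c r x a b → c + x * ((x + - r) * a + b) ≡ (x + - r) * (b + x * a) + (c + r * b)
    lemma = solve-∀ ℚ-ring

  length-quotient : ∀ r c p → length (quotient r (c ∷ p)) ≡ length p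
  length-quotient r c []          = refl
  length-quotient r c (d ∷ p)     = cong suc (length-quotient r d p)

  +-*0 : ∀ c r → c ≡ c + r * 0ℚ
  +-*0 = solve-∀ ℚ-ring

  -- The coefficients of the quotient are the values at `r` of the nonempty proper tails of `p`.
  -- Once the tail after `c` vanishes at `r`, the value of `p` at `r` is `c` itself.
  quotient≈0 : ∀ r p → quotient r p ≈ [] → eval p r ≡ 0ℚ → p ≈ []
  quotient≈0 r []       q≈0 e k       = refl
  quotient≈0 r (c ∷ []) q≈0 e zero    = trans (+-*0 c r) e
  quotient≈0 r (c ∷ []) q≈0 e (suc k) = refl
  quotient≈0 r (c ∷ p@(_ ∷ _)) q≈0 e (suc k) = quotient≈0 r p (λ k → q≈0 (suc k)) (q≈0 0) k
  quotient≈0 r (c ∷ p@(_ ∷ _)) q≈0 e zero    = begin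
    c                ≡⟨ +-*0 c r ⟩
    c + r * 0ℚ       ≡⟨ cong (λ v → c + r * v) (q≈0 0) ⟨
    c + r * eval p r ≡⟨ e ⟩
    0ℚ ∎

  -- Induction on the number of coefficients: dividing by `t - N` shortens the list, and the
  -- quotient still vanishes at every `a > N`, since there the factor `a - N` is a positive integer
  -- and can be cancelled.
  eventually-0⇒≈0 : ∀ p N → (∀ a → N ≤ a → eval p (ι a) ≡ 0ℚ) → p ≈ []
  eventually-0⇒≈0 p = go (length p) p refl
    where
    go : ∀ n p → length p ≡ n → ∀ N → (∀ a → N ≤ a → eval p (ι a) ≡ 0ℚ) → p ≈ []
    go n       []      _ N h = λ _ → refl
    go (suc n) (c ∷ p) l N h = quotient≈0 (ι N) (c ∷ p)
      (go n (quotient (ι N) (c ∷ p)) (trans (length-quotient (ι N) c p) (ℕ.suc-injective l)) (suc N) h′)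
      (h N ℕ.≤-refl)
      where
      q = quotient (ι N) (c ∷ p)
      h′ : ∀ a → suc N ≤ a → eval q (ι a) ≡ 0ℚ
      h′ a N<a with ℕ.m≤n⇒∃[o]m+o≡n N<a
      ... | d , refl = ι-*-cancelʳ (suc d) (begin
        eval q (ι a) * ι (suc d)                                ≡⟨ *-comm (eval q (ι a)) _ ⟩
        ι (suc d) * eval q (ι a)                                ≡⟨ cong (_* eval q (ι a)) diff ⟨
        (ι a + - ι N) * eval q (ι a)                            ≡⟨ +-identityʳ _ ⟨
        (ι a + - ι N) * eval q (ι a) + 0ℚ                       ≡⟨ cong (λ v → (ι a + - ι N) * eval q (ι a) + v) (h N ℕ.≤-refl) ⟨
        (ι a + - ι N) * eval q (ι a) + eval (c ∷ p) (ι N)       ≡⟨ eval-quotient (ι N) (c ∷ p) (ι a) ⟨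
        eval (c ∷ p) (ι a)                                      ≡⟨ h a (ℕ.<⇒≤ N<a) ⟩
        0ℚ                                                      ≡⟨ *-zeroˡ (ι (suc d)) ⟨
        0ℚ * ι (suc d) ∎)
        where
        lemma : ∀ x y → x + y + - x ≡ y
        lemma = solve-∀ ℚ-ring
        diff : ι (suc (N ℕ.+ d)) + - ι N ≡ ι (suc d)
        diff = trans (cong (λ k → ι k + - ι N) (sym (ℕ.+-suc N d)))
                     (trans (cong (_+ - ι N) (ι-+ N (suc d))) (lemma (ι N) (ι (suc d))))

  eventually-≡⇒≈ : ∀ p q N → (∀ a → N ≤ a → eval p (ι a) ≡ eval q (ι a)) → p ≈ q
  eventually-≡⇒≈ p q N h k = begin
    coeff p k                                   ≡⟨ lemma₁ _ (coeff q k) ⟩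
    coeff p k + - 1ℚ * coeff q k + coeff q k    ≡⟨ cong (λ v → coeff p k + v + coeff q k) (coeff-⊙ (- 1ℚ) q k) ⟨
    coeff p k + coeff (- 1ℚ ⊙ q) k + coeff q k  ≡⟨ cong (_+ coeff q k) (coeff-⊕ p (- 1ℚ ⊙ q) k) ⟨
    coeff (p ⊕ - 1ℚ ⊙ q) k + coeff q k          ≡⟨ cong (_+ coeff q k) (eventually-0⇒≈0 (p ⊕ - 1ℚ ⊙ q) N zeros k) ⟩
    0ℚ + coeff q k                              ≡⟨ +-identityˡ _ ⟩
    coeff q k ∎
    where
    lemma₁ : ∀ x y → x ≡ x + - 1ℚ * y + y
    lemma₁ = solve-∀ ℚ-ring
    lemma₂ : ∀ x → x + - 1ℚ * x ≡ 0ℚ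
    lemma₂ = solve-∀ ℚ-ring
    zeros : ∀ a → N ≤ a → eval (p ⊕ - 1ℚ ⊙ q) (ι a) ≡ 0ℚ
    zeros a N≤a rewrite eval-⊕ p (- 1ℚ ⊙ q) (ι a) | eval-⊙ (- 1ℚ) q (ι a) | h a N≤a = lemma₂ (eval q (ι a))

  -- The eigenbasis of the recurrence operator

  -- basis k is (2t + 1)(2t - 1) ⋯ (2t - 2k + 3); it diagonalises 𝓛 below.
  basis : ℕ → Polynomial
  basis zero    = 1ℚ ∷ []
  basis (suc k) = affine-* (1ℚ + - (ι k + ι k)) (1ℚ + 1ℚ) (basis k)

  length-basis : ∀ k → length (basis k) ≤ suc k
  length-basis zero    = ℕ.≤-refl
  length-basis (suc k) = length-⊕ (u ⊙ basis k) (0ℚ ∷ v ⊙ basis k)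
    (length-⊙ u (basis k) (ℕ.m≤n⇒m≤1+n (length-basis k)))
    (s≤s (length-⊙ v (basis k) (length-basis k)))
    where
    u = 1ℚ + - (ι k + ι k)
    v = 1ℚ + 1ℚ

  eval-basis-suc : ∀ k x → eval (basis (suc k)) x ≡ (x + x + 1ℚ + - (ι k + ι k)) * eval (basis k) x
  eval-basis-suc k x = trans (eval-affine-* (1ℚ + - (ι k + ι k)) (1ℚ + 1ℚ) (basis k) x) (lemma (ι k) x (eval (basis k) x))
    where
    lemma : ∀ k x b → (1ℚ + - (k + k) + (1ℚ + 1ℚ) * x) * b ≡ (x + x + 1ℚ + - (k + k)) * b
    lemma = solve-∀ ℚ-ring

  3ℚ : ℚ
  3ℚ = 1ℚ + 1ℚ + 1ℚ

  -- Both sides are (2x + 3)(2x + 1) ⋯ (2x - 2k + 3). This identity is what makes `𝓛` diagonal: it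
  -- turns the value at `x` into a multiple of the value at `x + 1`.
  basis-shift : ∀ k x → (x + x + 3ℚ) * eval (basis k) x ≡
                        (x + x + 3ℚ + - (ι k + ι k)) * eval (basis k) (x + 1ℚ)
  basis-shift zero    x = trans (lemma x 3ℚ)
    (cong (λ z → (x + x + 3ℚ + - (z + z)) * eval (basis 0) (x + 1ℚ)) (sym ι-0))
    where
    lemma : ∀ x t → (x + x + t) * (1ℚ + x * 0ℚ) ≡ (x + x + t + - (0ℚ + 0ℚ)) * (1ℚ + (x + 1ℚ) * 0ℚ)
    lemma = solve-∀ ℚ-ring
  basis-shift (suc k) x = begin
    (x + x + 3ℚ) * eval (basis (suc k)) x
      ≡⟨ cong ((x + x + 3ℚ) *_) (eval-basis-suc k x) ⟩
    (x + x + 3ℚ) * ((x + x + 1ℚ + - (κ + κ)) * b)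
      ≡⟨ lemma₁ (x + x + 3ℚ) (x + x + 1ℚ + - (κ + κ)) b ⟩
    (x + x + 1ℚ + - (κ + κ)) * ((x + x + 3ℚ) * b)
      ≡⟨ cong ((x + x + 1ℚ + - (κ + κ)) *_) (basis-shift k x) ⟩
    (x + x + 1ℚ + - (κ + κ)) * ((x + x + 3ℚ + - (κ + κ)) * b′)
      ≡⟨ lemma₂ x κ b′ ⟩
    (x + x + 3ℚ + - (1ℚ + κ + (1ℚ + κ))) * ((x + 1ℚ + (x + 1ℚ) + 1ℚ + - (κ + κ)) * b′)
      ≡⟨ cong₂ (λ v w → (x + x + 3ℚ + - (v + v)) * w) (ι-suc k) (eval-basis-suc k (x + 1ℚ)) ⟨
    (x + x + 3ℚ + - (ι (suc k) + ι (suc k))) * eval (basis (suc k)) (x + 1ℚ) ∎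
    where
    κ = ι k
    b = eval (basis k) x
    b′ = eval (basis k) (x + 1ℚ)
    lemma₁ : ∀ a b c → a * (b * c) ≡ b * (a * c)
    lemma₁ = solve-∀ ℚ-ring
    lemma₂ : ∀ x k b → (x + x + 1ℚ + - (k + k)) * ((x + x + (1ℚ + 1ℚ + 1ℚ) + - (k + k)) * b) ≡
             (x + x + (1ℚ + 1ℚ + 1ℚ) + - (1ℚ + k + (1ℚ + k))) * ((x + 1ℚ + (x + 1ℚ) + 1ℚ + - (k + k)) * b)
    lemma₂ = solve-∀ ℚ-ring

  -- The values of `basis k` at naturals `n` with `k ≤ suc n`, the range in which no factor is
  -- truncated. Being a product of successors, it can be divided by; the case `k = suc n` serves to
  -- place the root of the solution.
  oddProduct : ℕ → ℕ → ℕ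
  oddProduct n zero    = 1
  oddProduct n (suc k) = suc (2 ℕ.* (n ∸ k)) ℕ.* oddProduct n k

  oddProduct-nonZero : ∀ n k → NonZero (oddProduct n k)
  oddProduct-nonZero n zero    = _
  oddProduct-nonZero n (suc k) = ℕ.m*n≢0 (suc (2 ℕ.* (n ∸ k))) (oddProduct n k) {{_}} {{oddProduct-nonZero n k}}

  ι-∸ : ∀ {n k} → k ≤ n → ι (n ∸ k) ≡ ι n + - ι k
  ι-∸ {n} {k} k≤n = begin
    ι (n ∸ k)                  ≡⟨ lemma (ι (n ∸ k)) (ι k) ⟩
    ι (n ∸ k) + ι k + - ι k    ≡⟨ cong (_+ - ι k) (ι-+ (n ∸ k) k) ⟨
    ι (n ∸ k ℕ.+ k) + - ι k    ≡⟨ cong (λ m → ι m + - ι k) (ℕ.m∸n+n≡m k≤n) ⟩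
    ι n + - ι k ∎
    where
    lemma : ∀ x y → x ≡ x + y + - y
    lemma = solve-∀ ℚ-ring

  ι-odd : ∀ n → ι (suc (2 ℕ.* n)) ≡ 1ℚ + (ι n + ι n)
  ι-odd n = trans (ι-suc (2 ℕ.* n))
    (cong (λ v → 1ℚ + v) (trans (cong (λ m → ι (n ℕ.+ m)) (ℕ.+-identityʳ n)) (ι-+ n n)))

  eval-basis : ∀ n k → k ≤ suc n → eval (basis k) (ι n) ≡ ι (oddProduct n k)
  eval-basis n zero    _         = trans (lemma (ι n)) (sym ι-1)
    where
    lemma : ∀ x → 1ℚ + x * 0ℚ ≡ 1ℚ
    lemma = solve-∀ ℚ-ring
  eval-basis n (suc k) (s≤s k≤n) = begin
    eval (basis (suc k)) (ι n)                                  ≡⟨ eval-basis-suc k (ι n) ⟩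
    (ι n + ι n + 1ℚ + - (ι k + ι k)) * eval (basis k) (ι n)     ≡⟨ cong₂ _*_ (lemma (ι n) (ι k)) (eval-basis n k (ℕ.m≤n⇒m≤1+n k≤n)) ⟩
    (1ℚ + (ι n + - ι k + (ι n + - ι k))) * ι (oddProduct n k)   ≡⟨ cong (λ v → (1ℚ + (v + v)) * ι (oddProduct n k)) (ι-∸ k≤n) ⟨
    (1ℚ + (ι (n ∸ k) + ι (n ∸ k))) * ι (oddProduct n k)         ≡⟨ cong (_* ι (oddProduct n k)) (ι-odd (n ∸ k)) ⟨
    ι (suc (2 ℕ.* (n ∸ k))) * ι (oddProduct n k)                ≡⟨ ι-* (suc (2 ℕ.* (n ∸ k))) (oddProduct n k) ⟨
    ι (oddProduct n (suc k)) ∎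
    where
    lemma : ∀ n k → n + n + 1ℚ + - (k + k) ≡ 1ℚ + (n + - k + (n + - k))
    lemma = solve-∀ ℚ-ring

  -- Solving the recurrence by polynomials

  -- The coefficient of basis k comes before k further ones.
  combine : List ℚ → Polynomial
  combine []       = []
  combine (c ∷ cs) = c ⊙ basis (length cs) ⊕ combine cs

  eval-combine : ∀ c cs x → eval (combine (c ∷ cs)) x ≡ c * eval (basis (length cs)) x + eval (combine cs) x
  eval-combine c cs x = trans (eval-⊕ (c ⊙ basis (length cs)) (combine cs) x)
    (cong (_+ eval (combine cs) x) (eval-⊙ c (basis (length cs)) x))

  length-combine : ∀ cs → length (combine cs) ≤ length cs
  length-combine []       = z≤n
  length-combine (c ∷ cs) = length-⊕ (c ⊙ basis (length cs)) (combine cs)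
    (length-⊙ c (basis (length cs)) (length-basis (length cs))) (ℕ.m≤n⇒m≤1+n (length-combine cs))

  -- The operator p ↦ (2(a - i) + 1) p(a) - (2a + 1) p(a - 1) at a = x + 1.
  𝓛 : ℕ → (ℚ → ℚ) → ℚ → ℚ
  𝓛 i f x = (x + x + 3ℚ + - (ι i + ι i)) * f (x + 1ℚ) + - ((x + x + 3ℚ) * f x)

  𝓛-basis : ∀ i k x → 𝓛 i (eval (basis k)) x ≡ - (ι i + - ι k + (ι i + - ι k)) * eval (basis k) (x + 1ℚ)
  𝓛-basis i k x = trans
    (cong (λ v → (x + x + 3ℚ + - (ι i + ι i)) * eval (basis k) (x + 1ℚ) + - v) (basis-shift k x))
    (lemma x 3ℚ (ι i) (ι k) (eval (basis k) (x + 1ℚ)))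
    where
    lemma : ∀ x t i k b → (x + x + t + - (i + i)) * b + - ((x + x + t + - (k + k)) * b) ≡
                          - (i + - k + (i + - k)) * b
    lemma = solve-∀ ℚ-ring

  -- Divides the coefficient of basis k by the eigenvalue 2 (k - i) of 𝓛 i, where
  -- i - k = 1 + t.
  antidifference : ℕ → List ℚ → List ℚ
  antidifference t []       = []
  antidifference t (c ∷ cs) = - (½ * recip (suc t)) * c ∷ antidifference (suc t) cs

  length-antidifference : ∀ t cs → length (antidifference t cs) ≡ length cs
  length-antidifference t []       = refl
  length-antidifference t (c ∷ cs) = cong suc (length-antidifference (suc t) cs)

  𝓛-+ : ∀ i c f g h x → (∀ y → h y ≡ c * f y + g y) → 𝓛 i h x ≡ c * 𝓛 i f x + 𝓛 i g x
  𝓛-+ i c f g h x e = trans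
    (cong₂ (λ v w → (x + x + 3ℚ + - (ι i + ι i)) * v + - ((x + x + 3ℚ) * w)) (e (x + 1ℚ)) (e x))
    (lemma (x + x + 3ℚ + - (ι i + ι i)) (x + x + 3ℚ) c (f (x + 1ℚ)) (g (x + 1ℚ)) (f x) (g x))
    where
    lemma : ∀ a b c f′ g′ f g → a * (c * f′ + g′) + - (b * (c * f + g)) ≡
                                 c * (a * f′ + - (b * f)) + (a * g′ + - (b * g))
    lemma = solve-∀ ℚ-ring

  -- The head of `cs` belongs to `basis (i - 1 - t)`, so the list stays below `basis i`, the kernel
  -- of `𝓛 i`, and every eigenvalue met is `- 2 (1 + t)` for some `t ≥ 0`.
  𝓛-antidifference : ∀ i t cs x → length cs ℕ.+ t ≡ i →
    𝓛 i (eval (combine (antidifference t cs))) x ≡ eval (combine cs) (x + 1ℚ)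
  𝓛-antidifference i t []       x e = lemma (x + x + 3ℚ + - (ι i + ι i)) (x + x + 3ℚ)
    where
    lemma : ∀ a b → a * 0ℚ + - (b * 0ℚ) ≡ 0ℚ
    lemma = solve-∀ ℚ-ring
  𝓛-antidifference i t (c ∷ cs) x e = begin
    𝓛 i (eval (combine (antidifference t (c ∷ cs)))) x
      ≡⟨ 𝓛-+ i d (eval (basis k)) (eval (combine ds)) _ x (λ y → trans (eval-combine d ds y)
           (cong (λ l → d * eval (basis l) y + eval (combine ds) y) (length-antidifference (suc t) cs))) ⟩
    d * 𝓛 i (eval (basis k)) x + 𝓛 i (eval (combine ds)) x
      ≡⟨ cong₂ (λ u v → d * u + v) (𝓛-basis i k x)
           (𝓛-antidifference i (suc t) cs x (trans (ℕ.+-suc k t) e)) ⟩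
    d * (- (ι i + - ι k + (ι i + - ι k)) * b) + eval (combine cs) (x + 1ℚ)
      ≡⟨ cong (λ v → d * (- (v + v) * b) + eval (combine cs) (x + 1ℚ)) gap ⟩
    - (½ * r) * c * (- (ι (suc t) + ι (suc t)) * b) + eval (combine cs) (x + 1ℚ)
      ≡⟨ cong (_+ eval (combine cs) (x + 1ℚ)) (lemma r c (ι (suc t)) b) ⟩
    (½ + ½) * (r * ι (suc t)) * (c * b) + eval (combine cs) (x + 1ℚ)
      ≡⟨ cong (λ v → (½ + ½) * v * (c * b) + eval (combine cs) (x + 1ℚ)) (recip-* (suc t)) ⟩
    1ℚ * 1ℚ * (c * b) + eval (combine cs) (x + 1ℚ)
      ≡⟨ cong (_+ eval (combine cs) (x + 1ℚ)) (trans (cong (_* (c * b)) (*-identityʳ 1ℚ)) (*-identityˡ (c * b))) ⟩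
    c * b + eval (combine cs) (x + 1ℚ)
      ≡⟨ eval-combine c cs (x + 1ℚ) ⟨
    eval (combine (c ∷ cs)) (x + 1ℚ) ∎
    where
    k = length cs
    r = recip (suc t)
    d = - (½ * r) * c
    ds = antidifference (suc t) cs
    b = eval (basis k) (x + 1ℚ)
    gap : ι i + - ι k ≡ ι (suc t)
    gap = trans (cong (λ m → ι m + - ι k) (sym (trans (ℕ.+-suc k t) e)))
         (trans (cong (_+ - ι k) (ι-+ k (suc t))) (lemma′ (ι k) (ι (suc t))))
      where
      lemma′ : ∀ x y → x + y + - x ≡ y
      lemma′ = solve-∀ ℚ-ring
    lemma″ : ∀ h r c s b → - (h * r) * c * (- (s + s) * b) ≡ (h + h) * (r * s) * (c * b)
    lemma″ = solve-∀ ℚ-ring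
    lemma = lemma″ ½

  -- Chosen so that solution-root holds.
  correction : ℕ → List ℚ → ℚ
  correction i cs =
    - (eval (combine cs) (ι i) * recip (oddProduct i (suc i)) {{oddProduct-nonZero i (suc i)}})

  -- The tail is a particular solution of the recurrence; the head multiplies `basis (suc i)`, which
  -- `𝓛 (suc i)` annihilates, and is thus free to enforce the root at `i`.
  coordinates : ℕ → List ℚ
  coordinates zero    = 1ℚ ∷ []
  coordinates (suc i) = correction i cs ∷ cs
    where cs = antidifference 0 (coordinates i)

  length-coordinates : ∀ i → length (coordinates i) ≡ suc i
  length-coordinates zero    = refl
  length-coordinates (suc i) = cong suc (trans (length-antidifference 0 (coordinates i)) (length-coordinates i))

  solution : ℕ → Polynomial
  solution i = combine (coordinates i)

  solution-degree : ∀ i → DegreeAtMost i (solution i)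
  solution-degree i = length⇒degree (solution i)
    (ℕ.≤-trans (length-combine (coordinates i)) (ℕ.≤-reflexive (length-coordinates i)))

  eval-solution-suc : ∀ i x → let cs = antidifference 0 (coordinates i) in
    eval (solution (suc i)) x ≡ correction i cs * eval (basis (suc i)) x + eval (combine cs) x
  eval-solution-suc i x = trans (eval-combine (correction i cs) cs x)
    (cong (λ l → correction i cs * eval (basis l) x + eval (combine cs) x)
      (trans (length-antidifference 0 (coordinates i)) (length-coordinates i)))
    where cs = antidifference 0 (coordinates i)

  solution-0 : ∀ x → eval (solution 0) x ≡ 1ℚ
  solution-0 x = lemma x
    where
    lemma : ∀ x → 1ℚ * 1ℚ + x * 0ℚ ≡ 1ℚ
    lemma = solve-∀ ℚ-ring

  solution-root : ∀ i → eval (solution (suc i)) (ι i) ≡ 0ℚ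
  solution-root i = begin
    eval (solution (suc i)) (ι i)                   ≡⟨ eval-solution-suc i (ι i) ⟩
    - (y * r) * eval (basis (suc i)) (ι i) + y      ≡⟨ cong (λ v → - (y * r) * v + y) (eval-basis i (suc i) ℕ.≤-refl) ⟩
    - (y * r) * ι n + y                             ≡⟨ lemma₁ y r (ι n) ⟩
    - (y * (r * ι n)) + y                           ≡⟨ cong (λ v → - (y * v) + y) (recip-* n {{n≢0}}) ⟩
    - (y * 1ℚ) + y                                  ≡⟨ lemma₂ y ⟩
    0ℚ ∎
    where
    n = oddProduct i (suc i)
    n≢0 = oddProduct-nonZero i (suc i)
    r = recip n {{n≢0}}
    y = eval (combine (antidifference 0 (coordinates i))) (ι i)
    lemma₁ : ∀ y r n → - (y * r) * n + y ≡ - (y * (r * n)) + y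
    lemma₁ = solve-∀ ℚ-ring
    lemma₂ : ∀ y → - (y * 1ℚ) + y ≡ 0ℚ
    lemma₂ = solve-∀ ℚ-ring

  𝓛-solution : ∀ i x → 𝓛 (suc i) (eval (solution (suc i))) x ≡ eval (solution i) (x + 1ℚ)
  𝓛-solution i x = begin
    𝓛 (suc i) (eval (solution (suc i))) x
      ≡⟨ 𝓛-+ (suc i) c (eval (basis (suc i))) (eval (combine cs)) _ x (eval-solution-suc i) ⟩
    c * 𝓛 (suc i) (eval (basis (suc i))) x + 𝓛 (suc i) (eval (combine cs)) x
      ≡⟨ cong₂ (λ u v → c * u + v) (𝓛-basis (suc i) (suc i) x)
           (𝓛-antidifference (suc i) 0 (coordinates i) x (trans (ℕ.+-identityʳ _) (length-coordinates i))) ⟩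
    c * (- (ι (suc i) + - ι (suc i) + (ι (suc i) + - ι (suc i))) * eval (basis (suc i)) (x + 1ℚ)) + eval (solution i) (x + 1ℚ)
      ≡⟨ lemma c (ι (suc i)) (eval (basis (suc i)) (x + 1ℚ)) (eval (solution i) (x + 1ℚ)) ⟩
    eval (solution i) (x + 1ℚ) ∎
    where
    cs = antidifference 0 (coordinates i)
    c = correction i cs
    lemma : ∀ c k b s → c * (- (k + - k + (k + - k)) * b) + s ≡ s
    lemma = solve-∀ ℚ-ring

  -- This is `𝓛-solution` at `x = ι u`, that is, the recurrence at a = u + 1; with `i ≤ u` the
  -- truncated `u ∸ i` is the true difference.
  solution-recurrence : ∀ i u → i ≤ u →
    ι (suc (2 ℕ.* (u ∸ i))) * eval (solution (suc i)) (ι (suc u)) ≡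
    ι (suc (2 ℕ.* suc u)) * eval (solution (suc i)) (ι u) + eval (solution i) (ι (suc u))
  solution-recurrence i u i≤u = begin
    ι (suc (2 ℕ.* (u ∸ i))) * p (ι (suc u))
      ≡⟨ cong (_* p (ι (suc u))) (trans (ι-odd (u ∸ i)) (cong (λ v → 1ℚ + (v + v)) (ι-∸ i≤u))) ⟩
    (1ℚ + (ι u + - ι i + (ι u + - ι i))) * p (ι (suc u))
      ≡⟨ cong (λ v → (1ℚ + (ι u + - ι i + (ι u + - ι i))) * p v) ι-1+ ⟩
    (1ℚ + (ι u + - ι i + (ι u + - ι i))) * p (ι u + 1ℚ)
      ≡⟨ lemma₁ (ι u) (ι i) (p (ι u + 1ℚ)) (p (ι u)) ⟩
    (1ℚ + (ι u + 1ℚ + (ι u + 1ℚ))) * p (ι u) +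
      ((ι u + ι u + (1ℚ + 1ℚ + 1ℚ) + - (1ℚ + ι i + (1ℚ + ι i))) * p (ι u + 1ℚ) + - ((ι u + ι u + (1ℚ + 1ℚ + 1ℚ)) * p (ι u)))
      ≡⟨ cong (λ k → (1ℚ + (ι u + 1ℚ + (ι u + 1ℚ))) * p (ι u) +
           ((ι u + ι u + 3ℚ + - (k + k)) * p (ι u + 1ℚ) + - ((ι u + ι u + 3ℚ) * p (ι u)))) (ι-suc i) ⟨
    (1ℚ + (ι u + 1ℚ + (ι u + 1ℚ))) * p (ι u) + 𝓛 (suc i) p (ι u)
      ≡⟨ cong (λ v → (1ℚ + (ι u + 1ℚ + (ι u + 1ℚ))) * p (ι u) + v) (𝓛-solution i (ι u)) ⟩
    (1ℚ + (ι u + 1ℚ + (ι u + 1ℚ))) * p (ι u) + eval (solution i) (ι u + 1ℚ)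
      ≡⟨ cong (λ v → (1ℚ + (v + v)) * p (ι u) + eval (solution i) v) ι-1+ ⟨
    (1ℚ + (ι (suc u) + ι (suc u))) * p (ι u) + eval (solution i) (ι (suc u))
      ≡⟨ cong (λ v → v * p (ι u) + eval (solution i) (ι (suc u))) (ι-odd (suc u)) ⟨
    ι (suc (2 ℕ.* suc u)) * p (ι u) + eval (solution i) (ι (suc u)) ∎
    where
    p = eval (solution (suc i))
    ι-1+ : ι (suc u) ≡ ι u + 1ℚ
    ι-1+ = trans (cong ι (sym (ℕ.+-comm u 1))) (trans (ι-+ u 1) (cong (λ v → ι u + v) ι-1))
    lemma₁ : ∀ u i p′ p → (1ℚ + (u + - i + (u + - i))) * p′ ≡
      (1ℚ + (u + 1ℚ + (u + 1ℚ))) * p +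
      ((u + u + (1ℚ + 1ℚ + 1ℚ) + - (1ℚ + i + (1ℚ + i))) * p′ + - ((u + u + (1ℚ + 1ℚ + 1ℚ)) * p))
    lemma₁ = solve-∀ ℚ-ring

  -- From integer recurrences to polynomial ratios

  module Ratios (T : ℕ → ℕ → ℕ) (R : ℕ → ℕ)
    (T-zero : ∀ u → T (suc u) 0 ℕ.* suc (2 ℕ.* suc u) ≡ R u ℕ.* T u 0)
    (T-suc : ∀ u i → suc i ≤ u →
      T (suc u) (suc i) ℕ.* suc (2 ℕ.* (u ∸ i)) ≡ T (suc u) i ℕ.+ R u ℕ.* T u (suc i))
    (T-diagonal : ∀ u → T (suc u) (suc u) ℕ.* suc (2 ℕ.* (u ∸ u)) ≡ T (suc u) u)
    (T-nonZero : ∀ u → NonZero (T u 0)) where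

    -- Double induction along the recurrence, through `(i , suc u)` and `(suc i , u)`. `T-zero`
    -- trades `T (suc u) 0` times its odd factor for `R u * T u 0`, so that `R u` appears in both
    -- recurrences in the same way.
    solution-ratio : ∀ i u → i ≤ u → eval (solution i) (ι u) * ι (T u 0) ≡ ι (T u i)
    solution-ratio zero    u       _         =
      trans (cong (_* ι (T u 0)) (solution-0 (ι u))) (*-identityˡ _)
    solution-ratio (suc i) (suc u) (s≤s i≤u) = ι-*-cancelʳ o (begin
      p (ι (suc u)) * ι (T (suc u) 0) * ι o
        ≡⟨ lemma₁ (p (ι (suc u))) (ι (T (suc u) 0)) (ι o) ⟩
      ι o * p (ι (suc u)) * ι (T (suc u) 0)
        ≡⟨ cong (_* ι (T (suc u) 0)) (solution-recurrence i u i≤u) ⟩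
      (ι (suc (2 ℕ.* suc u)) * p (ι u) + eval (solution i) (ι (suc u))) * ι (T (suc u) 0)
        ≡⟨ lemma₂ (ι (suc (2 ℕ.* suc u))) (p (ι u)) (eval (solution i) (ι (suc u))) (ι (T (suc u) 0)) ⟩
      ι (T (suc u) 0) * ι (suc (2 ℕ.* suc u)) * p (ι u) + eval (solution i) (ι (suc u)) * ι (T (suc u) 0)
        ≡⟨ cong₂ (λ v w → v * p (ι u) + w)
             (trans (sym (ι-* (T (suc u) 0) (suc (2 ℕ.* suc u)))) (trans (cong ι (T-zero u)) (ι-* (R u) (T u 0))))
             (solution-ratio i (suc u) (ℕ.m≤n⇒m≤1+n i≤u)) ⟩
      ι (R u) * ι (T u 0) * p (ι u) + ι (T (suc u) i)
        ≡⟨ lemma₃ (ι (R u)) (ι (T u 0)) (p (ι u)) (ι (T (suc u) i)) ⟩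
      ι (T (suc u) i) + ι (R u) * (p (ι u) * ι (T u 0))
        ≡⟨ last (ℕ.m≤n⇒m<n∨m≡n i≤u) ⟩
      ι (T (suc u) (suc i) ℕ.* o)
        ≡⟨ ι-* (T (suc u) (suc i)) o ⟩
      ι (T (suc u) (suc i)) * ι o ∎)
      where
      p = eval (solution (suc i))
      o = suc (2 ℕ.* (u ∸ i))
      lemma₄ : ∀ a b c → a + b * (0ℚ * c) ≡ a
      lemma₄ = solve-∀ ℚ-ring
      last : suc i ≤ u ⊎ i ≡ u → ι (T (suc u) i) + ι (R u) * (p (ι u) * ι (T u 0)) ≡ ι (T (suc u) (suc i) ℕ.* o)
      last (inj₁ 1+i≤u) = begin
        ι (T (suc u) i) + ι (R u) * (p (ι u) * ι (T u 0))  ≡⟨ cong (λ v → ι (T (suc u) i) + ι (R u) * v) (solution-ratio (suc i) u 1+i≤u) ⟩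
        ι (T (suc u) i) + ι (R u) * ι (T u (suc i))        ≡⟨ cong (λ v → ι (T (suc u) i) + v) (ι-* (R u) (T u (suc i))) ⟨
        ι (T (suc u) i) + ι (R u ℕ.* T u (suc i))          ≡⟨ ι-+ (T (suc u) i) _ ⟨
        ι (T (suc u) i ℕ.+ R u ℕ.* T u (suc i))            ≡⟨ cong ι (T-suc u i 1+i≤u) ⟨
        ι (T (suc u) (suc i) ℕ.* o) ∎
      -- On the diagonal the recurrence for `T` lacks the term from `u`; the matching term of the
      -- polynomial recurrence vanishes by the choice of `correction`.
      last (inj₂ refl) = begin
        ι (T (suc u) i) + ι (R u) * (p (ι u) * ι (T u 0))  ≡⟨ cong (λ v → ι (T (suc u) i) + ι (R u) * (v * ι (T u 0))) (solution-root i) ⟩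
        ι (T (suc u) i) + ι (R u) * (0ℚ * ι (T u 0))       ≡⟨ lemma₄ (ι (T (suc u) i)) (ι (R u)) (ι (T u 0)) ⟩
        ι (T (suc u) i)                                    ≡⟨ cong ι (T-diagonal u) ⟨
        ι (T (suc u) (suc i) ℕ.* o) ∎
      lemma₁ : ∀ a b c → a * b * c ≡ c * a * b
      lemma₁ = solve-∀ ℚ-ring
      lemma₂ : ∀ a b c d → (a * b + c) * d ≡ d * a * b + c * d
      lemma₂ = solve-∀ ℚ-ring
      lemma₃ : ∀ a b c d → a * b * c + d ≡ d + a * (c * b)
      lemma₃ = solve-∀ ℚ-ring

    ∃!-ratio : (c : ℕ → ℕ → ℕ) → (∀ a i → i ≤ a → c a (a ∸ i) ≡ T a i) → (i : ℕ) →
      ∃! _≈_ λ P →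
        DegreeAtMost i P ×
        ((a : ℕ) → i ≤ a →
          Σ (NonZero (c a a)) λ nz →
            eval P ((+ a) / 1) ≡ _/_ (+ c a (a ∸ i)) (c a a) {{nz}})
    ∃!-ratio c c≡T i = solution i , (solution-degree i , λ a i≤a → c-nonZero a , ratio a i≤a) , λ {Q} → unique Q
      where
      c-nonZero : ∀ a → NonZero (c a a)
      c-nonZero a = subst NonZero (sym (c≡T a 0 z≤n)) (T-nonZero a)

      ratio : ∀ a → i ≤ a → eval (solution i) ((+ a) / 1) ≡ _/_ (+ c a (a ∸ i)) (c a a) {{c-nonZero a}}
      ratio a i≤a = /-unique (c a a) {{c-nonZero a}} (begin
        eval (solution i) ((+ a) / 1) * ι (c a a)  ≡⟨ cong₂ (λ x n → eval (solution i) x * ι n) (sym (ι-def a)) (c≡T a 0 z≤n) ⟩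
        eval (solution i) (ι a) * ι (T a 0)        ≡⟨ solution-ratio i a i≤a ⟩
        ι (T a i)                                  ≡⟨ cong ι (c≡T a i i≤a) ⟨
        ι (c a (a ∸ i))                            ∎)

      unique : ∀ Q → DegreeAtMost i Q × ((a : ℕ) → i ≤ a → Σ (NonZero (c a a)) λ nz →
                 eval Q ((+ a) / 1) ≡ _/_ (+ c a (a ∸ i)) (c a a) {{nz}}) → solution i ≈ Q
      unique Q (_ , h) = eventually-≡⇒≈ (solution i) Q i λ a i≤a →
        subst (λ x → eval (solution i) x ≡ eval Q x) (sym (ι-def a))
              (trans (ratio a i≤a) (sym (proj₂ (h a i≤a))))

module ExcitedDiagrams where

  open import Data.Empty using (⊥)
  open import Data.List using (List; []; _∷_; _++_; map; filter; length; upTo)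
  open import Data.List.Membership.Propositional using (_∈_; _∉_)
  open import Data.List.Membership.Propositional.Properties
    using (∈-map⁺; ∈-map⁻; ∈-++⁺ˡ; ∈-++⁺ʳ; ∈-++⁻; ∈-upTo⁺; ∈-upTo⁻; ∈-filter⁺; ∈-filter⁻)
  open import Data.List.Membership.Propositional.Properties.WithK using (unique∧set⇒bag)
  open import Data.List.Properties
    using (map-∘; map-++; length-map; length-upTo; length-++; map-cong-local; ∷-injectiveʳ;
           map-cong)
  open import Data.List.Relation.Binary.BagAndSetEquality using (∼bag⇒↭)
  open import Data.List.Relation.Binary.Permutation.Propositional
    using (_↭_; ↭-refl; ↭-sym; ↭-trans; ↭⇒↭ₛ)
  open import Data.List.Relation.Binary.Permutation.Propositional.Properties
    using (∈-resp-↭; ↭-length; filter-↭; map⁺)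
  import Data.List.Relation.Binary.Permutation.Setoid.Properties as ↭ₛ
  import Data.List.Relation.Unary.All as All
  open import Data.List.Relation.Unary.All using (All; []; _∷_)
  import Data.List.Relation.Unary.All.Properties as All
  open import Data.List.Relation.Unary.AllPairs using ([]; _∷_)
  open import Data.List.Relation.Unary.Any using (here; there; _─_)
  open import Data.List.Relation.Unary.Linked using (Linked)
  open import Data.List.Relation.Unary.Unique.Propositional using (Unique)
  import Data.List.Relation.Unary.Unique.Propositional.Properties as Unique
  open import Data.Nat
    using (ℕ; zero; suc; _+_; _*_; _∸_; _≤_; _<_; z≤n; s≤s; _≤?_; _<?_; _≟_; NonZero; _≥_)
  open import Data.Nat.ListAction using (sum; product)
  open import Data.Nat.ListAction.Properties
    using (sum-++; sum-↭; product-↭; product-++; product≢0)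
  open import Data.Nat.Properties
  open import Data.Product using (∃-syntax; _×_; _,_; proj₁; proj₂)
  open import Data.Sum using (_⊎_; inj₁; inj₂; [_,_]′)
  open import Function using (_∘_; mk⇔; Equivalence; _⇔_)
  open import Relation.Binary.Definitions using (tri<; tri≈; tri>)
  open import Relation.Binary.PropositionalEquality
  open import Relation.Nullary using (Dec; yes; no; ¬_; contradiction; ¬?)
  open import Relation.Nullary.Decidable using (_⊎-dec_; _×-dec_; dec-true; dec-false)

  open import Data.List.Membership.DecPropositional _≟_ using (_∈?_)
  open Equivalence using (to; from)

  -- Repetition-free lists and diagrams

  module _ {A : Set} where

    -- Sums, products and lengths below are reindexed through this: for repetition-free lists it is
    -- enough to compare members.
    unique∧⊆⇒↭ : ∀ {xs ys : List A} → Unique xs → Unique ys →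
                 (∀ {z} → z ∈ xs → z ∈ ys) → (∀ {z} → z ∈ ys → z ∈ xs) → xs ↭ ys
    unique∧⊆⇒↭ uxs uys f g = ∼bag⇒↭ (unique∧set⇒bag uxs uys (mk⇔ f g))

    Unique-resp-↭ : ∀ {xs ys : List A} → xs ↭ ys → Unique xs → Unique ys
    Unique-resp-↭ p = ↭ₛ.Unique-resp-↭ (setoid A) (↭⇒↭ₛ p)

    unique-head : ∀ {x : A} {xs} → Unique (x ∷ xs) → x ∉ xs
    unique-head = Unique.Unique[x∷xs]⇒x∉xs

  0∉diagram : ∀ xs {j} → (0 , j) ∉ diagram xs
  0∉diagram xs c∈ with to (∈-diagram xs) c∈
  ... | 1≤j , j≤0 = contradiction (≤-trans 1≤j j≤0) λ ()

  0th∉diagram : ∀ xs {i} → (i , 0) ∉ diagram xs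
  0th∉diagram xs c∈ = contradiction (proj₁ (to (∈-diagram xs) c∈)) λ ()

  diagram-unique : ∀ xs → Unique (diagram xs)
  diagram-unique []       = []
  diagram-unique (x ∷ xs) = Unique.++⁺
    (Unique.map⁺ (λ { refl → refl }) (Unique.upTo⁺ x))
    (Unique.map⁺ (λ { refl → refl }) (diagram-unique xs))
    disjoint
    where
    disjoint : ∀ {c} → ¬ (c ∈ map (λ j → 1 , suc j) (upTo x) × c ∈ map below (diagram xs))
    disjoint (p , q) with ∈-map⁻ _ p | ∈-map⁻ below q
    ... | _ , _ , refl | (zero , _) , c∈ , refl = 0∉diagram xs c∈

  -- Lattice paths encoded by profiles

  -- The profile m describes a lattice path whose cells in row i are those in
  -- columns 1 + m i, …, 1 + m (i - 1); Off holds off this path.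
  Off : (ℕ → ℕ) → Cell → Set
  Off m (zero  , j) = ⊥
  Off m (suc k , j) = j ≤ m (suc k) ⊎ suc (m k) < j

  Off? : ∀ m c → Dec (Off m c)
  Off? m (zero  , j) = no λ ()
  Off? m (suc k , j) = (j ≤? m (suc k)) ⊎-dec (suc (m k) <? j)

  off : (ℕ → ℕ) → List ℕ → List Cell
  off m xs = filter (Off? m) (diagram xs)

  off-unique : ∀ m xs → Unique (off m xs)
  off-unique m xs = Unique.filter⁺ (Off? m) (diagram-unique xs)

  ∈-off⁺ : ∀ m xs {c} → c ∈ diagram xs → Off m c → c ∈ off m xs
  ∈-off⁺ m xs = ∈-filter⁺ (Off? m)

  ∈-off⁻ : ∀ m xs {c} → c ∈ off m xs → c ∈ diagram xs × Off m c
  ∈-off⁻ m xs = ∈-filter⁻ (Off? m) {xs = diagram xs}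

  Off-cong : ∀ {m m′} → (∀ k → m k ≡ m′ k) → ∀ {c} → Off m c → Off m′ c
  Off-cong e {suc k , j} (inj₁ j≤) = inj₁ (subst (j ≤_) (e (suc k)) j≤)
  Off-cong e {suc k , j} (inj₂ <j) = inj₂ (subst (λ v → suc v < j) (e k) <j)

  off-cong : ∀ {m m′} xs → (∀ k → m k ≡ m′ k) → off m xs ↭ off m′ xs
  off-cong {m} {m′} xs e = unique∧⊆⇒↭ (off-unique m xs) (off-unique m′ xs)
    (λ z∈ → let d , o = ∈-off⁻ m xs z∈ in ∈-off⁺ m′ xs d (Off-cong e o))
    (λ z∈ → let d , o = ∈-off⁻ m′ xs z∈ in ∈-off⁺ m xs d (Off-cong (sym ∘ e) o))

  -- `top` fixes the upper end of the path at the end of row 1. `bounded` keeps the rightmost path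
  -- cell of each row inside the diagram; past the last row it reads `m k ≤ 0 ∸ 1 = 0`, which fixes
  -- the lower end in column 1.
  record Profile (xs : List ℕ) (m : ℕ → ℕ) : Set where
    field
      top      : m 0 ≡ nth xs 1 ∸ 1
      antitone : ∀ k → m (suc k) ≤ m k
      bounded  : ∀ k → m k ≤ nth xs (suc k) ∸ 1

  open Profile

  -- Exciting the cell in row 1 + k and column m′ (1 + k) lowers m′ (1 + k) by one.
  off-excite : ∀ {m m′ xs k p E} → m′ (suc k) ≡ suc p → m (suc k) ≡ p →
    (∀ l → l ≢ suc k → m l ≡ m′ l) → suc p ≤ m′ k → (suc (suc k) , suc (suc p)) ∈ diagram xs →
    m′ (suc (suc k)) ≤ p → (suc k , suc p) ∷ E ↭ off m′ xs → off m xs ↭ (suc (suc k) , suc (suc p)) ∷ E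
  off-excite {m} {m′} {xs} {k} {p} {E} m′≡ m≡ m≗ p<m′ d∈ below≤p c∷E↭ =
    unique∧⊆⇒↭ (off-unique m xs) (All.tabulate (λ { z∈ refl → d∉E z∈ }) ∷ uniqueE) forth back
    where
    c d : Cell
    c = suc k , suc p
    d = suc (suc k) , suc (suc p)

    unique-c∷E : Unique (c ∷ E)
    unique-c∷E = Unique-resp-↭ (↭-sym c∷E↭) (off-unique m′ xs)

    uniqueE : Unique E
    uniqueE with unique-c∷E
    ... | _ ∷ u = u

    E⊆ : ∀ {z} → z ∈ E → z ∈ diagram xs × Off m′ z
    E⊆ z∈ = ∈-off⁻ m′ xs (∈-resp-↭ c∷E↭ (there z∈))

    m≡m′ : m k ≡ m′ k
    m≡m′ = m≗ k (1+n≢n ∘ sym)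

    Off-d : Off m d
    Off-d = inj₂ (≤-reflexive (cong (suc ∘ suc) m≡))

    -- Entry `suc k` bounds the path on the left in row `suc k` and on the right in row
    -- `suc (suc k)`. Lowering it puts `c` on the path in the former and frees `d` in the latter;
    -- the split on `l` isolates these two rows.
    lower : ∀ {z} → Off m z → z ≡ d ⊎ (Off m′ z × z ≢ c)
    lower {suc l , j} o with l ≟ k | l ≟ suc k
    lower {suc l , j} (inj₁ j≤) | yes refl | _ =
      inj₂ (inj₁ (subst (j ≤_) (sym m′≡) (m≤n⇒m≤1+n j≤p)) , λ { refl → 1+n≰n j≤p })
      where j≤p = subst (j ≤_) m≡ j≤
    lower {suc l , j} (inj₂ <j) | yes refl | _ =
      inj₂ (inj₂ <j′ , λ { refl → <⇒≱ <j′ (m≤n⇒m≤1+n p<m′) })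
      where <j′ = subst (λ v → suc v < j) m≡m′ <j
    lower {suc l , j} (inj₁ j≤) | no _ | yes refl =
      inj₂ (inj₁ (subst (j ≤_) (m≗ (suc (suc k)) 1+n≢n) j≤) , λ { () })
    lower {suc l , j} (inj₂ <j) | no _ | yes refl with m≤n⇒m<n∨m≡n (subst (λ v → suc v < j) m≡ <j)
    ... | inj₂ refl = inj₁ refl
    ... | inj₁ <j′  = inj₂ (inj₂ (subst (λ v → suc v < j) (sym m′≡) <j′) , λ { () })
    lower {suc l , j} (inj₁ j≤) | no l≢k | no l≢1+k =
      inj₂ (inj₁ (subst (j ≤_) (m≗ (suc l) (l≢k ∘ suc-injective)) j≤) , λ { refl → l≢k refl })
    lower {suc l , j} (inj₂ <j) | no l≢k | no l≢1+k =
      inj₂ (inj₂ (subst (λ v → suc v < j) (m≗ l l≢1+k) <j) , λ { refl → l≢k refl })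

    raise : ∀ {z} → Off m′ z → z ≢ c → Off m z
    raise {suc l , j} o z≢c with l ≟ k | l ≟ suc k
    raise {suc l , j} (inj₁ j≤) z≢c | yes refl | _ with m≤n⇒m<n∨m≡n (subst (j ≤_) m′≡ j≤)
    ... | inj₁ (s≤s j≤p) = inj₁ (subst (j ≤_) (sym m≡) j≤p)
    ... | inj₂ refl      = contradiction refl z≢c
    raise {suc l , j} (inj₂ <j) z≢c | yes refl | _ = inj₂ (subst (λ v → suc v < j) (sym m≡m′) <j)
    raise {suc l , j} (inj₁ j≤) z≢c | no _ | yes refl =
      inj₁ (subst (j ≤_) (sym (m≗ (suc (suc k)) 1+n≢n)) j≤)
    raise {suc l , j} (inj₂ <j) z≢c | no _ | yes refl =
      inj₂ (≤-trans (s≤s (s≤s (≤-trans (≤-reflexive m≡) (≤-trans (n≤1+n p) (≤-reflexive (sym m′≡)))))) <j)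
    raise {suc l , j} (inj₁ j≤) z≢c | no l≢k | no l≢1+k =
      inj₁ (subst (j ≤_) (sym (m≗ (suc l) (l≢k ∘ suc-injective))) j≤)
    raise {suc l , j} (inj₂ <j) z≢c | no l≢k | no l≢1+k =
      inj₂ (subst (λ v → suc v < j) (sym (m≗ l l≢1+k)) <j)

    d∉E : d ∉ E
    d∉E d∈E with proj₂ (E⊆ d∈E)
    ... | inj₁ p≤ = <⇒≱ p≤ (≤-trans below≤p (n≤1+n p))
    ... | inj₂ <p = 1+n≰n (subst (λ v → suc v < suc (suc p)) m′≡ <p)

    forth : ∀ {z} → z ∈ off m xs → z ∈ d ∷ E
    forth z∈ with ∈-off⁻ m xs z∈
    ... | z∈xs , o with lower o
    ... | inj₁ refl = here refl
    ... | inj₂ (o′ , z≢c) with ∈-resp-↭ (↭-sym c∷E↭) (∈-off⁺ m′ xs z∈xs o′)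
    ... | here z≡c = contradiction z≡c z≢c
    ... | there z∈E = there z∈E

    back : ∀ {z} → z ∈ d ∷ E → z ∈ off m xs
    back (here refl) = ∈-off⁺ m xs d∈ Off-d
    back (there z∈E) = ∈-off⁺ m xs (proj₁ (E⊆ z∈E))
      (raise (proj₂ (E⊆ z∈E)) λ { refl → unique-head unique-c∷E z∈E })

  _[_≔_] : (ℕ → ℕ) → ℕ → ℕ → ℕ → ℕ
  (m [ i ≔ v ]) k with k ≟ i
  ... | yes _ = v
  ... | no _  = m k

  ≔-same : ∀ m i v → (m [ i ≔ v ]) i ≡ v
  ≔-same m i v with i ≟ i
  ... | yes _  = refl
  ... | no i≢i = contradiction refl i≢i

  ≔-other : ∀ m i v k → k ≢ i → (m [ i ≔ v ]) k ≡ m k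
  ≔-other m i v k k≢i with k ≟ i
  ... | yes k≡i = contradiction k≡i k≢i
  ... | no _    = refl

  ≔-profile : ∀ {xs m} k v → Profile xs m → m (suc (suc k)) ≤ v → v ≤ m k → v ≤ nth xs (suc (suc k)) ∸ 1 →
              Profile xs (m [ suc k ≔ v ])
  ≔-profile {xs} {m} k v P lower upper bound = record { top = top P ; antitone = anti ; bounded = bnd }
    where
    m′ = m [ suc k ≔ v ]
    anti : ∀ l → m′ (suc l) ≤ m′ l
    anti l with suc l ≟ suc k | l ≟ suc k
    ... | yes refl | yes ()
    ... | yes refl | no _     = upper
    ... | no _     | yes refl = lower
    ... | no _     | no _     = antitone P l
    bnd : ∀ l → m′ l ≤ nth xs (suc l) ∸ 1
    bnd l with l ≟ suc k
    ... | yes refl = bound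
    ... | no _     = bounded P l

  outermost : List ℕ → ℕ → ℕ
  outermost xs k = nth xs (suc k) ∸ 1

  nth-beyond : ∀ (ys : List ℕ) {k} → length ys ≤ k → nth ys (suc k) ≡ 0
  nth-beyond []       _              = refl
  nth-beyond (y ∷ ys) {suc k} (s≤s l) = nth-beyond ys l

  -- Excited diagrams are the complements of paths

  module _ (Λ : Partition) where

    private
      xs = parts Λ

    outermost-profile : Profile xs (outermost xs)
    outermost-profile = record
      { top = refl ; antitone = λ k → ∸-monoˡ-≤ 1 (nth-mono (decreasing Λ) k) ; bounded = λ k → ≤-refl }

    off-outermost : off (outermost xs) xs ↭ 𝔻 (inner Λ)
    off-outermost = unique∧⊆⇒↭ (off-unique (outermost xs) xs) (diagram-unique (peel xs)) forth back
      where
      forth : ∀ {z} → z ∈ off (outermost xs) xs → z ∈ 𝔻 (inner Λ)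
      forth {zero , j} z∈ = contradiction (proj₁ (∈-off⁻ (outermost xs) xs z∈)) (0∉diagram xs)
      forth {suc k , j} z∈ with ∈-off⁻ (outermost xs) xs z∈
      ... | z∈xs , o with to (∈-diagram xs) z∈xs | o
      ... | 1≤j , j≤ | inj₁ j≤′ = from (∈-diagram (peel xs)) (1≤j , subst (j ≤_) (sym (nth-peel (decreasing Λ) k)) j≤′)
      ... | 1≤j , j≤ | inj₂ <j  = contradiction (≤-trans j≤ (m≤n+m∸n _ 1)) (<⇒≱ <j)
      back : ∀ {z} → z ∈ 𝔻 (inner Λ) → z ∈ off (outermost xs) xs
      back {zero , j} z∈ = contradiction z∈ (0∉diagram (peel xs))
      back {suc k , j} z∈ with to (∈-diagram (peel xs)) z∈
      ... | 1≤j , j≤ = ∈-off⁺ (outermost xs) xs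
        (from (∈-diagram xs) (1≤j , ≤-trans j≤′ (≤-trans (m∸n≤m _ 1) (nth-mono (decreasing Λ) k))))
        (inj₁ j≤′)
        where j≤′ = subst (j ≤_) (nth-peel (decreasing Λ) k) j≤

    -- The cells `right c` and `below c` belong to the diagram but not to the set, so they lie on
    -- the path. Hence `c` is the last cell left of the path in its row, and the entry of the
    -- profile there can drop by one without falling below the next entry.
    excited⇒profile : ∀ {D} → Excited Λ (inner Λ) D → ∃[ m ] Profile xs m × D ↭ off m xs
    excited⇒profile (initial D↭) = outermost xs , outermost-profile , ↭-trans D↭ (↭-sym off-outermost)
    excited⇒profile (excite {c} {E} {D} exc (d∈ , r∉ , b∉ , _) D↭) with excited⇒profile exc
    ... | m′ , P , c∷E↭ = lowered c c∈ c-off d∈ r∉ b∉ D↭ c∷E↭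
      where
      c∈ : c ∈ diagram xs
      c∈ = proj₁ (∈-off⁻ m′ xs (∈-resp-↭ c∷E↭ (here refl)))
      c-off : Off m′ c
      c-off = proj₂ (∈-off⁻ m′ xs (∈-resp-↭ c∷E↭ (here refl)))

      lowered : ∀ c → c ∈ diagram xs → Off m′ c → diag c ∈ diagram xs → right c ∉ c ∷ E → below c ∉ c ∷ E →
                D ↭ diag c ∷ E → c ∷ E ↭ off m′ xs → ∃[ m ] Profile xs m × D ↭ off m xs
      lowered (suc k , zero)  c∈ _ _ _ _ _ _ = contradiction c∈ (0th∉diagram xs)
      lowered (suc k , suc p) c∈ o d∈ r∉ b∉ D↭ c∷E↭ =
        m , ≔-profile k p P (≮⇒≥ p≮) (<⇒≤ p<m′k) (≤-trans (n≤1+n p) (≤-trans (≤-reflexive (sym m′≡)) (bounded P (suc k)))) ,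
        ↭-trans D↭ (↭-sym (off-excite {xs = xs} m′≡ (≔-same m′ (suc k) p) (≔-other m′ (suc k) p) p<m′k d∈ (≮⇒≥ p≮) c∷E↭))
        where
        m = m′ [ suc k ≔ p ]
        right-on : ¬ Off m′ (suc k , suc (suc p))
        right-on o = r∉ (∈-resp-↭ (↭-sym c∷E↭) (∈-off⁺ m′ xs (proj₁ (∈-closed Λ _ c∈ d∈)) o))
        below-on : ¬ Off m′ (suc (suc k) , suc p)
        below-on o = b∉ (∈-resp-↭ (↭-sym c∷E↭) (∈-off⁺ m′ xs (proj₂ (∈-closed Λ _ c∈ d∈)) o))
        p<m′k : suc p ≤ m′ k
        p<m′k = ≮⇒≥ λ lt → right-on (inj₂ (s≤s lt))
        p≮ : ¬ p < m′ (suc (suc k))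
        p≮ lt = below-on (inj₁ lt)
        m′≡ : m′ (suc k) ≡ suc p
        m′≡ = [ ≤-antisym (≮⇒≥ λ lt → right-on (inj₁ lt))
              , (λ <p → contradiction (m≤n⇒m≤1+n p<m′k) (<⇒≱ <p)) ]′ o

    -- Antitonicity before and after the change places the three neighbours of the cell to be
    -- excited on the path, and the bound on the raised entry places its target inside the diagram.
    excite-off : ∀ {m} k → Profile xs m → Profile xs (m [ suc k ≔ suc (m (suc k)) ]) →
      Excited Λ (inner Λ) (off (m [ suc k ≔ suc (m (suc k)) ]) xs) → Excited Λ (inner Λ) (off m xs)
    excite-off {m} k P P′ exc = excite (Excited-resp-↭ c∷E↭ exc) (d∈ , r∉ , b∉ , d∉)
      (off-excite {xs = xs} m′≡ refl (λ l l≢ → sym (≔-other m (suc k) (suc p) l l≢)) p<m′k d∈ below≤p (↭-sym c∷E↭))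
      where
      p = m (suc k)
      m′ = m [ suc k ≔ suc p ]
      m′≡ : m′ (suc k) ≡ suc p
      m′≡ = ≔-same m (suc k) (suc p)
      p<m′k : suc p ≤ m′ k
      p<m′k = subst (_≤ m′ k) m′≡ (antitone P′ k)
      below≤p : m′ (suc (suc k)) ≤ p
      below≤p = subst (_≤ p) (sym (≔-other m (suc k) (suc p) (suc (suc k)) 1+n≢n)) (antitone P (suc k))
      p<bound : suc p ≤ nth xs (suc (suc k)) ∸ 1
      p<bound = subst (_≤ nth xs (suc (suc k)) ∸ 1) m′≡ (bounded P′ (suc k))
      d∈ : (suc (suc k) , suc (suc p)) ∈ diagram xs
      d∈ = from (∈-diagram xs) (s≤s z≤n , m≤o∸n⇒m+n≤o′ p<bound)
        where
        m≤o∸n⇒m+n≤o′ : ∀ {a b} → suc a ≤ b ∸ 1 → suc (suc a) ≤ b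
        m≤o∸n⇒m+n≤o′ {b = suc b} a≤ = s≤s a≤
      c∈ : (suc k , suc p) ∈ off m′ xs
      c∈ = ∈-off⁺ m′ xs
        (from (∈-diagram xs) (s≤s z≤n , ≤-trans p<bound (≤-trans (m∸n≤m _ 1) (nth-mono (decreasing Λ) k))))
        (inj₁ (≤-reflexive (sym m′≡)))
      E : List Cell
      E = off m′ xs ─ c∈
      c∷E↭ : off m′ xs ↭ (suc k , suc p) ∷ E
      c∷E↭ = ─-↭ c∈
      on : ∀ {z} → z ∈ (suc k , suc p) ∷ E → Off m′ z
      on z∈ = proj₂ (∈-off⁻ m′ xs (∈-resp-↭ (↭-sym c∷E↭) z∈))
      r∉ : (suc k , suc (suc p)) ∉ (suc k , suc p) ∷ E
      r∉ z∈ with on z∈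
      ... | inj₁ p≤ = 1+n≰n (≤-trans p≤ (≤-reflexive m′≡))
      ... | inj₂ <p = <⇒≱ (≤-pred <p) p<m′k
      b∉ : (suc (suc k) , suc p) ∉ (suc k , suc p) ∷ E
      b∉ z∈ with on z∈
      ... | inj₁ p≤ = <⇒≱ p≤ below≤p
      ... | inj₂ <p = <⇒≱ (subst (λ v → suc v < suc p) m′≡ <p) (n≤1+n _)
      d∉ : (suc (suc k) , suc (suc p)) ∉ (suc k , suc p) ∷ E
      d∉ z∈ with on z∈
      ... | inj₁ p≤ = <⇒≱ p≤ (≤-trans below≤p (n≤1+n p))
      ... | inj₂ <p = 1+n≰n (subst (λ v → suc v < suc (suc p)) m′≡ <p)

    -- Excitations are undone row by row from the top, so that each lowered entry of
    -- m can be raised without breaking monotonicity.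
    profile⇒excited-from : ∀ n K → K + n ≡ length xs → ∀ {m} → Profile xs m →
      (∀ k → k ≤ K → m k ≡ outermost xs k) → Excited Λ (inner Λ) (off m xs)
    profile⇒excited-from zero K e {m} P agree = initial (↭-trans (off-cong xs agree′) off-outermost)
      where
      agree′ : ∀ k → m k ≡ outermost xs k
      agree′ k with k ≤? K
      ... | yes k≤K = agree k k≤K
      ... | no k≰K  = trans (n≤0⇒n≡0 (subst (m k ≤_) zero-bound (bounded P k))) (sym zero-bound)
        where
        zero-bound : outermost xs k ≡ 0
        zero-bound = cong (_∸ 1) (nth-beyond xs (subst (_≤ k) (trans (sym (+-identityʳ K)) e) (<⇒≤ (≰⇒> k≰K))))
    profile⇒excited-from (suc n) K e P agree = go _ P agree refl
      where
      go : ∀ t {m} → Profile xs m → (∀ k → k ≤ K → m k ≡ outermost xs k) →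
           outermost xs (suc K) ∸ m (suc K) ≡ t → Excited Λ (inner Λ) (off m xs)
      go zero {m} P agree gap = profile⇒excited-from n (suc K) (trans (sym (+-suc K n)) e) P agree′
        where
        agree′ : ∀ k → k ≤ suc K → m k ≡ outermost xs k
        agree′ k k≤ with m≤n⇒m<n∨m≡n k≤
        ... | inj₁ (s≤s k≤K) = agree k k≤K
        ... | inj₂ refl      = ≤-antisym (bounded P k) (m∸n≡0⇒m≤n gap)
      go (suc t) {m} P agree gap = excite-off K P P′ (go t P′ agree′ gap′)
        where
        p = m (suc K)
        p<bound : p < outermost xs (suc K)
        p<bound = m∸n≢0⇒n<m λ z → contradiction (trans (sym gap) z) λ ()
        P′ : Profile xs (m [ suc K ≔ suc p ])
        P′ = ≔-profile K (suc p) P (m≤n⇒m≤1+n (antitone P (suc K)))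
          (≤-trans p<bound (≤-trans (antitone outermost-profile K) (≤-reflexive (sym (agree K ≤-refl))))) p<bound
        agree′ : ∀ k → k ≤ K → (m [ suc K ≔ suc p ]) k ≡ outermost xs k
        agree′ k k≤ = trans (≔-other m (suc K) (suc p) k (<⇒≢ (s≤s k≤))) (agree k k≤)
        gap′ : outermost xs (suc K) ∸ (m [ suc K ≔ suc p ]) (suc K) ≡ t
        gap′ rewrite ≔-same m (suc K) (suc p) =
          trans (sym (pred[m∸n]≡m∸[1+n] (outermost xs (suc K)) p)) (cong (_∸ 1) gap)

    profile⇒excited : ∀ {m} → Profile xs m → Excited Λ (inner Λ) (off m xs)
    profile⇒excited P = profile⇒excited-from (length xs) 0 refl P λ { zero z≤n → top P }

  -- Subsets as canonical sublists

  module _ {A B : Set} (f : A → B) where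

    map-unique-local : ∀ {xs} → (∀ {x y} → x ∈ xs → y ∈ xs → f x ≡ f y → x ≡ y) → Unique xs → Unique (map f xs)
    map-unique-local inj []          = []
    map-unique-local {x ∷ xs} inj (x∉ ∷ u) =
      All.map⁺ (All.tabulate λ y∈ fx≡fy → All.lookup x∉ y∈ (inj (here refl) (there y∈) fx≡fy)) ∷
      map-unique-local (λ x∈ y∈ → inj (there x∈) (there y∈)) u

  ∈-subsets⇒⊆ : ∀ xs {D z} → D ∈ subsets xs → z ∈ D → z ∈ xs
  ∈-subsets⇒⊆ []       (here refl) ()
  ∈-subsets⇒⊆ (x ∷ xs) D∈ z∈ with ∈-++⁻ (map (x ∷_) (subsets xs)) D∈
  ... | inj₂ D∈′ = there (∈-subsets⇒⊆ xs D∈′ z∈)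
  ... | inj₁ D∈′ with ∈-map⁻ (x ∷_) D∈′ | z∈
  ...   | _ , E∈ , refl | here refl = here refl
  ...   | _ , E∈ , refl | there z∈E = there (∈-subsets⇒⊆ xs E∈ z∈E)

  filter∈subsets : ∀ {P : Cell → Set} (P? : ∀ c → Dec (P c)) xs → filter P? xs ∈ subsets xs
  filter∈subsets P? []       = here refl
  filter∈subsets P? (x ∷ xs) with P? x
  ... | yes _ = ∈-++⁺ˡ (∈-map⁺ (x ∷_) (filter∈subsets P? xs))
  ... | no _  = ∈-++⁺ʳ (map (x ∷_) (subsets xs)) (filter∈subsets P? xs)

  subsets-unique : ∀ {xs} → Unique xs → Unique (subsets xs)
  subsets-unique []                    = [] ∷ []
  subsets-unique {x ∷ xs} u@(_ ∷ u′) = Unique.++⁺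
    (Unique.map⁺ ∷-injectiveʳ (subsets-unique u′)) (subsets-unique u′) disjoint
    where
    disjoint : ∀ {D} → ¬ (D ∈ map (x ∷_) (subsets xs) × D ∈ subsets xs)
    disjoint (p , q) with ∈-map⁻ (x ∷_) p
    ... | _ , _ , refl = unique-head u (∈-subsets⇒⊆ xs q (here refl))

  -- A sublist inherits its order from `xs`, so its elements determine it. This upgrades `↭` to `≡`
  -- for the members of `𝔼`, so that each excited diagram is counted once.
  subsets-ext : ∀ {xs} → Unique xs → ∀ {D E} → D ∈ subsets xs → E ∈ subsets xs →
                (∀ {z} → z ∈ D → z ∈ E) → (∀ {z} → z ∈ E → z ∈ D) → D ≡ E
  subsets-ext []                   (here refl) (here refl) f g = refl
  subsets-ext {x ∷ xs} u@(_ ∷ u′) D∈ E∈ f g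
    with ∈-++⁻ (map (x ∷_) (subsets xs)) D∈ | ∈-++⁻ (map (x ∷_) (subsets xs)) E∈
  ... | inj₂ D∈′ | inj₂ E∈′ = subsets-ext u′ D∈′ E∈′ f g
  ... | inj₁ D∈′ | inj₂ E∈′ with ∈-map⁻ (x ∷_) D∈′
  ...   | _ , _ , refl = contradiction (∈-subsets⇒⊆ xs E∈′ (f (here refl))) (unique-head u)
  subsets-ext {x ∷ xs} u@(_ ∷ u′) D∈ E∈ f g | inj₂ D∈′ | inj₁ E∈′ with ∈-map⁻ (x ∷_) E∈′
  ...   | _ , _ , refl = contradiction (∈-subsets⇒⊆ xs D∈′ (g (here refl))) (unique-head u)
  subsets-ext {x ∷ xs} u@(_ ∷ u′) D∈ E∈ f g | inj₁ D∈′ | inj₁ E∈′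
    with ∈-map⁻ (x ∷_) D∈′ | ∈-map⁻ (x ∷_) E∈′
  ... | D , D∈″ , refl | E , E∈″ , refl = cong (x ∷_) (subsets-ext u′ D∈″ E∈″ (restrict D∈″ f) (restrict E∈″ g))
    where
    restrict : ∀ {F G} → F ∈ subsets xs → (∀ {z} → z ∈ x ∷ F → z ∈ x ∷ G) → ∀ {z} → z ∈ F → z ∈ G
    restrict F∈ h z∈ with h (there z∈)
    ... | here refl = contradiction (∈-subsets⇒⊆ xs F∈ z∈) (unique-head u)
    ... | there z∈G = z∈G

  -- The staircase shape and its hooks

  stair : ℕ → List ℕ
  stair zero    = []
  stair (suc n) = suc n ∷ stair n

  nth-stair : ∀ n k → nth (stair n) (suc k) ≡ n ∸ k
  nth-stair zero    zero    = refl
  nth-stair zero    (suc k) = refl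
  nth-stair (suc n) zero    = refl
  nth-stair (suc n) (suc k) = nth-stair n k

  ∈-stair : ∀ n {i j} → (suc i , suc j) ∈ diagram (stair n) ⇔ i + j < n
  ∈-stair n {i} {j} = mk⇔ f g
    where
    f : (suc i , suc j) ∈ diagram (stair n) → i + j < n
    f c∈ = subst (_≤ n) (trans (+-suc j i) (cong suc (+-comm j i)))
      (m<n∸o⇒m+o<n (subst (suc j ≤_) (nth-stair n i) (proj₂ (to (∈-diagram (stair n)) c∈))))
      where
      m<n∸o⇒m+o<n : suc j ≤ n ∸ i → j + suc i ≤ n
      m<n∸o⇒m+o<n lt = subst (_≤ n) (sym (+-suc j i)) (m≤o∸n⇒m+n≤o (suc j) i≤n lt)
        where
        i≤n : i ≤ n
        i≤n = <⇒≤ (m∸n≢0⇒n<m λ z → contradiction (subst (suc j ≤_) z lt) λ ())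
    g : i + j < n → (suc i , suc j) ∈ diagram (stair n)
    g lt = from (∈-diagram (stair n)) (s≤s z≤n , subst (suc j ≤_) (sym (nth-stair n i))
      (m+n≤o⇒m≤o∸n (suc j) (subst (_≤ n) (cong suc (+-comm i j)) lt)))

  2*k+1 : ∀ k → 2 * k + 1 ≡ suc (k + k)
  2*k+1 k = trans (+-comm (2 * k) 1) (cong (λ v → suc (k + v)) (+-identityʳ k))

  -- An even step lengthens the first row and the following odd step duplicates it, so every pair of
  -- steps adds one row to the staircase.
  shape-odds : ∀ a k → k ≤ a → shape (elements (odds a)) (suc (k + k)) ≡ suc k ∷ stair (suc k)
  shape-odds a = go
    where
    E = elements (odds a)

    odd∈ : ∀ {k} → k ≤ a → suc (k + k) ∈ E
    odd∈ {k} k≤ = subst (_∈ E) (2*k+1 k) (∈-map⁺ (λ k → 2 * k + 1) {xs = upTo (suc a)} (∈-upTo⁺ (s≤s k≤)))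

    even∉ : ∀ {k} → suc (suc (k + k)) ∉ E
    even∉ {k} p with ∈-map⁻ (λ k → 2 * k + 1) {xs = upTo (suc a)} p
    ... | j , _ , e = even≢odd (suc k) j (trans (cong suc (trans (+-suc k (k + 0)) (cong (λ v → suc (k + v)) (+-identityʳ k)))) (trans e (+-comm (2 * j) 1)))

    go : ∀ k → k ≤ a → shape E (suc (k + k)) ≡ suc k ∷ stair (suc k)
    go zero    _   rewrite dec-true (1 ∈? E) (odd∈ {0} z≤n) = refl
    go (suc k) k<a rewrite +-suc k k
      | dec-true (suc (suc (suc (k + k))) ∈? E) (subst (λ v → suc (suc v) ∈ E) (+-suc k k) (odd∈ k<a))
      | dec-false (suc (suc (k + k)) ∈? E) (even∉ {k})
      | go k (<⇒≤ k<a) = refl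

  maxElement-odds : ∀ a → maxElement (odds a) ≡ suc (a + a)
  maxElement-odds a = ≤-antisym upper lower
    where
    I = odds a
    E = elements I
    lower : suc (a + a) ≤ maxElement I
    lower = ≤-max E (subst (_∈ E) (2*k+1 a) (∈-map⁺ (λ k → 2 * k + 1) {xs = upTo (suc a)} (∈-upTo⁺ (s≤s ≤-refl))))
    upper : maxElement I ≤ suc (a + a)
    upper with ∈-map⁻ (λ k → 2 * k + 1) {xs = upTo (suc a)} (max-∈ E (DescentSet.nonempty I) (DescentSet.positive I))
    ... | k , k∈ , e with ∈-upTo⁻ k∈
    ... | s≤s k≤a = ≤-trans (≤-reflexive (trans e (2*k+1 k))) (s≤s (+-mono-≤ k≤a k≤a))

  parts-odds : ∀ a → parts (λ^ (odds a)) ≡ suc a ∷ stair (suc a)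
  parts-odds a = trans (cong (shape (elements (odds a))) (maxElement-odds a)) (shape-odds a a ≤-refl)

  InHook : Cell → Cell → Set
  InHook c d = (row d ≡ row c × col c ≤ col d) ⊎ (col d ≡ col c × row c ≤ row d)

  InHook? : ∀ c d → Dec (InHook c d)
  InHook? c d = ((row d ≟ row c) ×-dec (col c ≤? col d)) ⊎-dec ((col d ≟ col c) ×-dec (row c ≤? row d))

  -- Arm and leg of a staircase cell have the same length `suc n ∸ (i + j)`.
  stairHook : ℕ → Cell → ℕ
  stairHook n (i , j) = suc (2 * (suc n ∸ (i + j)))

  -- The top row of length `x` meets no hook of a lower cell, so hooks are those of the staircase
  -- alone.
  hook-below : ∀ Λ {x n c} → parts Λ ≡ x ∷ stair n → c ∈ diagram (stair n) → hook Λ (below c) ≡ stairHook n c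
  hook-below Λ {x} {n} {zero , j}      e c∈ = contradiction c∈ (0∉diagram (stair n))
  hook-below Λ {x} {n} {suc i , zero}  e c∈ = contradiction c∈ (0th∉diagram (stair n))
  hook-below Λ {x} {n} {suc i , suc j} e c∈ = begin
    hook Λ c                                    ≡⟨⟩
    length (filter (InHook? c) (diagram (parts Λ)))       ≡⟨ cong (length ∘ filter (InHook? c) ∘ diagram) e ⟩
    length (filter (InHook? c) (diagram (x ∷ stair n)))   ≡⟨ ↭-length (unique∧⊆⇒↭ unique₁ unique₂ forth back) ⟩
    length (arm ++ leg)                         ≡⟨ length-++ arm ⟩
    length arm + length leg                     ≡⟨ cong₂ _+_ (trans (length-map _ (upTo (suc t))) (length-upTo (suc t)))
                                                             (trans (length-map _ (upTo t)) (length-upTo t)) ⟩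
    suc (t + t)                                 ≡⟨ cong (λ v → suc (t + v)) (+-identityʳ t) ⟨
    suc (2 * t)                                 ≡⟨ cong (λ v → suc (2 * (n ∸ v))) (+-suc i j) ⟨
    stairHook n (suc i , suc j)                 ∎
    where
    open ≡-Reasoning
    c : Cell
    c = suc (suc i) , suc j
    t = n ∸ suc (i + j)
    -- The corner `c` is counted in `arm`, which therefore has one cell more than `leg`.
    arm leg : List Cell
    arm = map (λ k → suc (suc i) , suc (j + k)) (upTo (suc t))
    leg = map (λ k → suc (suc (suc (i + k))) , suc j) (upTo t)

    n≡ : n ≡ suc (i + j) + t
    n≡ = sym (m+[n∸m]≡n (to (∈-stair n) c∈))

    ∈below : ∀ {i j} → i + j < n → (suc (suc i) , suc j) ∈ diagram (x ∷ stair n)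
    ∈below lt = ∈-++⁺ʳ (map (λ j → 1 , suc j) (upTo x)) (∈-map⁺ below (from (∈-stair n) lt))

    below∈ : ∀ {i j} → (suc (suc i) , suc j) ∈ diagram (x ∷ stair n) → i + j < n
    below∈ {i} {j} d∈ = to (∈-stair n) (from (∈-diagram (stair n)) (to (∈-diagram (x ∷ stair n)) d∈))

    unique₁ : Unique (filter (InHook? c) (diagram (x ∷ stair n)))
    unique₁ = Unique.filter⁺ (InHook? c) (diagram-unique (x ∷ stair n))
    unique₂ : Unique (arm ++ leg)
    unique₂ = Unique.++⁺
      (Unique.map⁺ (λ { {k} {l} e → +-cancelˡ-≡ j k l (suc-injective (cong col e)) }) (Unique.upTo⁺ (suc t)))
      (Unique.map⁺ (λ { {k} {l} e → +-cancelˡ-≡ i k l (suc-injective (suc-injective (suc-injective (cong row e)))) }) (Unique.upTo⁺ t))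
      disjoint
      where
      disjoint : ∀ {d} → ¬ (d ∈ arm × d ∈ leg)
      disjoint (p , q) with ∈-map⁻ _ p | ∈-map⁻ _ q
      ... | _ , _ , refl | _ , _ , e = m≢1+m+n i (suc-injective (suc-injective (cong row e)))

    ∈arm : ∀ k → i + (j + k) < n → (suc (suc i) , suc (j + k)) ∈ arm
    ∈arm k lt = ∈-map⁺ _ (∈-upTo⁺ (s≤s (+-cancelˡ-≤ (i + j) k t
      (≤-pred (subst₂ _≤_ (cong suc (sym (+-assoc i j k))) n≡ lt)))))

    ∈leg : ∀ k → suc (i + k) + j < n → (suc (suc (suc (i + k))) , suc j) ∈ leg
    ∈leg k lt = ∈-map⁺ _ (∈-upTo⁺ (+-cancelˡ-< (suc (i + j)) k t (subst₂ _<_ shuffle n≡ lt)))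
      where
      shuffle : suc (i + k) + j ≡ suc (i + j) + k
      shuffle = cong suc (trans (+-assoc i k j) (trans (cong (λ v → i + v) (+-comm k j)) (sym (+-assoc i j k))))

    forth : ∀ {d} → d ∈ filter (InHook? c) (diagram (x ∷ stair n)) → d ∈ arm ++ leg
    forth d∈ with ∈-filter⁻ (InHook? c) {xs = diagram (x ∷ stair n)} d∈
    ... | d∈xs , inj₁ (refl , j≤) with m≤n⇒∃[o]m+o≡n j≤
    ...   | k , refl = ∈-++⁺ˡ (∈arm k (below∈ d∈xs))
    forth d∈ | d∈xs , inj₂ (refl , i≤) with m≤n⇒∃[o]m+o≡n i≤
    ...   | zero , refl = ∈-++⁺ˡ (subst₂ (λ r s → (suc (suc r) , suc s) ∈ arm) (sym (+-identityʳ i)) (+-identityʳ j)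
                            (∈arm 0 (subst₂ (λ r s → r + s < n) (+-identityʳ i) (sym (+-identityʳ j)) (below∈ d∈xs))))
    ...   | suc k , refl = ∈-++⁺ʳ arm (subst (λ r → (suc (suc r) , suc j) ∈ leg) (sym (+-suc i k))
                            (∈leg k (subst (λ r → r + j < n) (+-suc i k) (below∈ d∈xs))))

    back : ∀ {d} → d ∈ arm ++ leg → d ∈ filter (InHook? c) (diagram (x ∷ stair n))
    back d∈ with ∈-++⁻ arm d∈
    ... | inj₁ p with ∈-map⁻ _ p
    ...   | k , k∈ , refl with ∈-upTo⁻ k∈
    ...     | s≤s k≤t = ∈-filter⁺ (InHook? c)
      (∈below (subst₂ _≤_ (cong suc (+-assoc i j k)) (sym n≡) (s≤s (+-monoʳ-≤ (i + j) k≤t))))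
      (inj₁ (refl , s≤s (m≤m+n j k)))
    back d∈ | inj₂ p with ∈-map⁻ _ p
    ...   | k , k∈ , refl = ∈-filter⁺ (InHook? c)
      (∈below (subst₂ _<_ shuffle (sym n≡) (+-monoʳ-< (suc (i + j)) (∈-upTo⁻ k∈))))
      (inj₂ (refl , s≤s (s≤s (m≤n⇒m≤1+n (m≤m+n i k)))))
      where
      shuffle : suc (i + j) + k ≡ suc (i + k) + j
      shuffle = cong suc (trans (+-assoc i j k) (trans (cong (λ v → i + v) (+-comm j k)) (sym (+-assoc i k j))))

  -- Enumeration of the paths through the staircase

  -- The continuations m 1, …, m u of the profiles with m 0 = d of the staircase
  -- with rows of lengths u + 1, …, 1.
  seqs : ℕ → ℕ → List (List ℕ)
  seqs zero    d       = [] ∷ []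
  seqs (suc u) zero    = map (0 ∷_) (seqs u 0)
  -- A head at most `d` means that the path goes left from column `2 + d`. The head `suc d` means
  -- that it goes straight down, which requires the next row, of length `suc u`, to reach that
  -- column.
  seqs (suc u) (suc d) with suc d ≤? u
  ... | yes _ = seqs (suc u) d ++ map (suc d ∷_) (seqs u (suc d))
  ... | no _  = seqs (suc u) d

  seqs-last : ∀ u d → suc d ≤ u → seqs (suc u) (suc d) ≡ seqs (suc u) d ++ map (suc d ∷_) (seqs u (suc d))
  seqs-last u d d<u with suc d ≤? u
  ... | yes _ = refl
  ... | no d≮u = contradiction d<u d≮u

  seqs-stable : ∀ u → seqs (suc u) (suc u) ≡ seqs (suc u) u
  seqs-stable u with suc u ≤? u
  ... | yes u<u = contradiction u<u 1+n≰n
  ... | no _    = refl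

  ∷∈seqs : ∀ {u d e es} → e ≤ d → e ≤ u → es ∈ seqs u e → e ∷ es ∈ seqs (suc u) d
  ∷∈seqs {u} {zero} z≤n e≤u es∈ = ∈-map⁺ (0 ∷_) es∈
  ∷∈seqs {u} {suc d} {e} e≤ e≤u es∈ with suc d ≤? u | m≤n⇒m<n∨m≡n e≤
  ... | yes _   | inj₁ (s≤s e≤d) = ∈-++⁺ˡ (∷∈seqs e≤d e≤u es∈)
  ... | yes _   | inj₂ refl      = ∈-++⁺ʳ (seqs (suc u) d) (∈-map⁺ (suc d ∷_) es∈)
  ... | no _    | inj₁ (s≤s e≤d) = ∷∈seqs e≤d e≤u es∈
  ... | no d≮u  | inj₂ refl      = contradiction e≤u d≮u

  data Headed (u d : ℕ) : List ℕ → Set where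
    headed : ∀ {e es} → e ≤ d → e ≤ u → es ∈ seqs u e → Headed u d (e ∷ es)

  Headed-suc : ∀ {u d es} → Headed u d es → Headed u (suc d) es
  Headed-suc (headed e≤d e≤u es∈) = headed (m≤n⇒m≤1+n e≤d) e≤u es∈

  seqs-headed : ∀ u d {es} → es ∈ seqs (suc u) d → Headed u d es
  seqs-headed u zero es∈ with ∈-map⁻ (0 ∷_) es∈
  ... | _ , fs∈ , refl = headed z≤n z≤n fs∈
  seqs-headed u (suc d) es∈ with suc d ≤? u
  ... | no _  = Headed-suc (seqs-headed u d es∈)
  ... | yes d<u with ∈-++⁻ (seqs (suc u) d) es∈
  ...   | inj₁ p = Headed-suc (seqs-headed u d p)
  ...   | inj₂ p with ∈-map⁻ (suc d ∷_) p
  ...     | _ , fs∈ , refl = headed ≤-refl d<u fs∈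

  seqs-unique : ∀ u d → Unique (seqs u d)
  seqs-unique zero    d       = [] ∷ []
  seqs-unique (suc u) zero    = Unique.map⁺ ∷-injectiveʳ (seqs-unique u 0)
  seqs-unique (suc u) (suc d) with suc d ≤? u
  ... | no _  = seqs-unique (suc u) d
  ... | yes _ = Unique.++⁺ (seqs-unique (suc u) d) (Unique.map⁺ ∷-injectiveʳ (seqs-unique u (suc d))) disjoint
    where
    disjoint : ∀ {es} → ¬ (es ∈ seqs (suc u) d × es ∈ map (suc d ∷_) (seqs u (suc d)))
    disjoint (p , q) with ∈-map⁻ (suc d ∷_) q | seqs-headed u d p
    ... | _ , _ , refl | headed d<d _ _ = 1+n≰n d<d

  seqs-length : ∀ u d {es} → es ∈ seqs u d → length es ≡ u
  seqs-length zero    d (here refl) = refl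
  seqs-length (suc u) d es∈ with seqs-headed u d es∈
  ... | headed {e} _ _ fs∈ = cong suc (seqs-length u e fs∈)

  nth-ext : ∀ es fs → length es ≡ length fs → (∀ k → nth es (suc k) ≡ nth fs (suc k)) → es ≡ fs
  nth-ext []       []       _ _ = refl
  nth-ext (e ∷ es) (f ∷ fs) l h = cong₂ _∷_ (h 0) (nth-ext es fs (suc-injective l) (h ∘ suc))

  profileOf : List ℕ → ℕ → ℕ
  profileOf es k = nth es (suc k)

  seqs-antitone : ∀ u d {es} → es ∈ seqs u d → ∀ k → profileOf (d ∷ es) (suc k) ≤ profileOf (d ∷ es) k
  seqs-antitone zero    d (here refl) k = z≤n
  seqs-antitone (suc u) d es∈ k with seqs-headed u d es∈ | k
  ... | headed e≤d _ _ | zero = e≤d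
  ... | headed {e} _ _ fs∈ | suc k = seqs-antitone u e fs∈ k

  seqs-bounded : ∀ u d {es} → d ≤ u → es ∈ seqs u d → ∀ k → profileOf (d ∷ es) k ≤ u ∸ k
  seqs-bounded u d d≤u es∈ zero = d≤u
  seqs-bounded zero    d d≤u (here refl) (suc k) = z≤n
  seqs-bounded (suc u) d d≤u es∈ (suc k) with seqs-headed u d es∈
  ... | headed {e} _ e≤u fs∈ = seqs-bounded u e e≤u fs∈ k

  seqs-complete : ∀ u (m : ℕ → ℕ) → (∀ k → m (suc k) ≤ m k) → (∀ k → m k ≤ u ∸ k) →
                  ∃[ es ] es ∈ seqs u (m 0) × (∀ k → profileOf (m 0 ∷ es) k ≡ m k)
  seqs-complete zero    m anti bnd = [] , here refl , λ { zero → refl ; (suc k) → sym (n≤0⇒n≡0 (bnd (suc k))) }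
  seqs-complete (suc u) m anti bnd with seqs-complete u (m ∘ suc) (anti ∘ suc) (bnd ∘ suc)
  ... | es , es∈ , agree = m 1 ∷ es , ∷∈seqs (anti 0) (bnd 1) es∈ , λ { zero → refl ; (suc k) → agree k }

  -- Path sums and their recurrence

  module _ {A : Set} where

    sum-map-scale : ∀ (c k : ℕ) {f g : A → ℕ} (xs : List A) → (∀ {x} → x ∈ xs → c * f x ≡ k * g x) →
                    c * sum (map f xs) ≡ k * sum (map g xs)
    sum-map-scale c k []       h = trans (*-zeroʳ c) (sym (*-zeroʳ k))
    sum-map-scale c k {f} {g} (x ∷ xs) h = trans (*-distribˡ-+ c (f x) _)
      (trans (cong₂ _+_ (h (here refl)) (sum-map-scale c k xs (h ∘ there))) (sym (*-distribˡ-+ k (g x) _)))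

  -- The number `d` of first-row cells of the excited diagram fixes the column `suc d` in which the
  -- path enters the staircase formed by the remaining rows.
  pathWeight : ℕ → ℕ → List ℕ → ℕ
  pathWeight u d es = product (map (stairHook (suc u)) (off (profileOf (d ∷ es)) (stair (suc u))))

  pathSum : ℕ → ℕ → ℕ
  pathSum u d = sum (map (pathWeight u d) (seqs u d))

  rowWeight : ℕ → ℕ
  rowWeight u = product (map (λ j → stairHook (suc (suc u)) (1 , suc j)) (upTo (suc (suc u))))

  -- Profile entry 0 affects row 1 only, and lowering it frees exactly the cell in column `2 + d`.
  -- The bound on the head of `es` ensures that this cell was on the path.
  pathWeight-left : ∀ u d {es} → suc d ≤ u → profileOf es 0 ≤ suc d →
                    pathWeight u d es ≡ suc (2 * (u ∸ suc d)) * pathWeight u (suc d) es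
  pathWeight-left u d {es} d<u h = product-↭ (map⁺ (stairHook (suc u))
    (unique∧⊆⇒↭ (off-unique m xs) (All.tabulate (λ { z∈ refl → fresh z∈ }) ∷ off-unique m′ xs) forth back))
    where
    xs = stair (suc u)
    m = profileOf (d ∷ es)
    m′ = profileOf (suc d ∷ es)
    new : Cell
    new = 1 , suc (suc d)
    fresh : new ∉ off m′ xs
    fresh z∈ with proj₂ (∈-off⁻ m′ xs z∈)
    ... | inj₁ ≤es = 1+n≰n (≤-trans ≤es h)
    ... | inj₂ lt  = 1+n≰n lt
    forth : ∀ {z} → z ∈ off m xs → z ∈ new ∷ off m′ xs
    forth {z} z∈ with ∈-off⁻ m xs z∈
    forth {zero , j} z∈ | z∈xs , ()
    forth {suc zero , j} z∈ | z∈xs , inj₁ j≤ = there (∈-off⁺ m′ xs z∈xs (inj₁ j≤))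
    forth {suc zero , j} z∈ | z∈xs , inj₂ <j with m≤n⇒m<n∨m≡n <j
    ... | inj₁ <j′ = there (∈-off⁺ m′ xs z∈xs (inj₂ <j′))
    ... | inj₂ refl = here refl
    forth {suc (suc k) , j} z∈ | z∈xs , o = there (∈-off⁺ m′ xs z∈xs o)
    back : ∀ {z} → z ∈ new ∷ off m′ xs → z ∈ off m xs
    back (here refl) = ∈-off⁺ m xs (from (∈-stair (suc u)) (s≤s d<u)) (inj₂ ≤-refl)
    back {z} (there z∈) with ∈-off⁻ m′ xs z∈
    back {zero , j} (there z∈) | z∈xs , ()
    back {suc zero , j} (there z∈) | z∈xs , inj₁ j≤ = ∈-off⁺ m xs z∈xs (inj₁ j≤)
    back {suc zero , j} (there z∈) | z∈xs , inj₂ <j = ∈-off⁺ m xs z∈xs (inj₂ (≤-trans (n≤1+n _) <j))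
    back {suc (suc k) , j} (there z∈) | z∈xs , o = ∈-off⁺ m xs z∈xs o

  -- A path that goes down at once uses a single cell of the first row; multiplying by the hook of
  -- that cell completes the row, and the rows below form the next smaller staircase.
  pathWeight-up : ∀ u d {es} → d ≤ suc u →
                  suc (2 * (suc u ∸ d)) * pathWeight (suc u) d (d ∷ es) ≡ rowWeight u * pathWeight u d es
  pathWeight-up u d {es} d≤ = begin
    product (map (stairHook (suc (suc u))) (new ∷ off m xs))
      ≡⟨ product-↭ (map⁺ (stairHook (suc (suc u))) cells) ⟩
    product (map (stairHook (suc (suc u))) (firstCells ++ map below (off m′ ys)))
      ≡⟨ cong product (map-++ (stairHook (suc (suc u))) firstCells _) ⟩
    product (map (stairHook (suc (suc u))) firstCells ++ map (stairHook (suc (suc u))) (map below (off m′ ys)))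
      ≡⟨ product-++ (map (stairHook (suc (suc u))) firstCells) _ ⟩
    product (map (stairHook (suc (suc u))) firstCells) * product (map (stairHook (suc (suc u))) (map below (off m′ ys)))
      -- `stairHook (suc (suc u)) (below c)` reduces to `stairHook (suc u) c`: hooks depend only on
      -- the distance to the border.
      ≡⟨ cong₂ (λ v w → product v * product w) (map-∘ {g = stairHook (suc (suc u))} {f = λ j → 1 , suc j} (upTo (suc (suc u))))
          (map-∘ {g = stairHook (suc (suc u))} {f = below} (off m′ ys)) ⟨
    rowWeight u * pathWeight u d es ∎
    where
    open ≡-Reasoning
    xs = stair (suc (suc u))
    ys = stair (suc u)
    m = profileOf (d ∷ d ∷ es)
    m′ = profileOf (d ∷ es)
    new : Cell
    new = 1 , suc d
    firstCells : List Cell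
    firstCells = map (λ j → 1 , suc j) (upTo (suc (suc u)))
    fresh : new ∉ off m xs
    fresh z∈ with proj₂ (∈-off⁻ m xs z∈)
    ... | inj₁ lt = 1+n≰n lt
    ... | inj₂ lt = 1+n≰n lt
    unique₂ : Unique (firstCells ++ map below (off m′ ys))
    unique₂ = Unique.++⁺ (Unique.map⁺ (λ { refl → refl }) (Unique.upTo⁺ (suc (suc u))))
      (Unique.map⁺ (λ { refl → refl }) (off-unique m′ ys)) disjoint
      where
      disjoint : ∀ {z} → ¬ (z ∈ firstCells × z ∈ map below (off m′ ys))
      disjoint (p , q) with ∈-map⁻ _ p | ∈-map⁻ below q
      ... | _ , _ , refl | (zero , _) , c∈ , refl = 0∉diagram ys (proj₁ (∈-off⁻ m′ ys c∈))
    forth : ∀ {z} → z ∈ new ∷ off m xs → z ∈ firstCells ++ map below (off m′ ys)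
    forth (here refl) = ∈-++⁺ˡ (∈-map⁺ _ (∈-upTo⁺ (s≤s d≤)))
    forth {z} (there z∈) with ∈-off⁻ m xs z∈
    ... | z∈xs , o with ∈-++⁻ firstCells z∈xs
    ... | inj₁ p = ∈-++⁺ˡ p
    ... | inj₂ p with ∈-map⁻ below p
    ... | (zero , _) , c∈ , refl = contradiction c∈ (0∉diagram ys)
    ... | (suc k , _) , c∈ , refl = ∈-++⁺ʳ firstCells (∈-map⁺ below (∈-off⁺ m′ ys c∈ o))
    back : ∀ {z} → z ∈ firstCells ++ map below (off m′ ys) → z ∈ new ∷ off m xs
    back {z} z∈ with ∈-++⁻ firstCells z∈
    ... | inj₁ p with ∈-map⁻ _ p
    ...   | j , j∈ , refl with <-cmp j d
    ...     | tri< j<d _ _ = there (∈-off⁺ m xs (∈-++⁺ˡ p) (inj₁ j<d))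
    ...     | tri≈ _ refl _ = here refl
    ...     | tri> _ _ d<j = there (∈-off⁺ m xs (∈-++⁺ˡ p) (inj₂ (s≤s d<j)))
    back {z} z∈ | inj₂ p with ∈-map⁻ below p
    ...   | (zero , _) , c∈ , refl = contradiction (proj₁ (∈-off⁻ m′ ys c∈)) (0∉diagram ys)
    ...   | (suc k , _) , c∈ , refl with ∈-off⁻ m′ ys c∈
    ...     | c∈ys , o = there (∈-off⁺ m xs (∈-++⁺ʳ firstCells (∈-map⁺ below c∈ys)) o)
    cells : new ∷ off m xs ↭ firstCells ++ map below (off m′ ys)
    cells = unique∧⊆⇒↭ (All.tabulate (λ { z∈ refl → fresh z∈ }) ∷ off-unique m xs) unique₂ forth back

  -- A path in column 1 can only go down, so no left term occurs.
  pathSum-zero : ∀ u → pathSum (suc u) 0 * suc (2 * suc u) ≡ rowWeight u * pathSum u 0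
  pathSum-zero u = begin
    pathSum (suc u) 0 * suc (2 * suc u)
      ≡⟨ *-comm (pathSum (suc u) 0) _ ⟩
    suc (2 * suc u) * sum (map (pathWeight (suc u) 0) (map (0 ∷_) (seqs u 0)))
      ≡⟨ cong (λ v → suc (2 * suc u) * sum v) (map-∘ (seqs u 0)) ⟨
    suc (2 * suc u) * sum (map (pathWeight (suc u) 0 ∘ (0 ∷_)) (seqs u 0))
      ≡⟨ sum-map-scale (suc (2 * suc u)) (rowWeight u) (seqs u 0) (λ {es} _ → pathWeight-up u 0 {es} z≤n) ⟩
    rowWeight u * pathSum u 0 ∎
    where open ≡-Reasoning

  seqs-left : ∀ u d → d ≤ u →
    suc (2 * (u ∸ d)) * sum (map (pathWeight (suc u) (suc d)) (seqs (suc u) d)) ≡ pathSum (suc u) d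
  seqs-left u d d≤u = trans
    (sum-map-scale (suc (2 * (u ∸ d))) 1 (seqs (suc u) d)
      (λ {es} es∈ → trans (sym (pathWeight-left (suc u) d {es} (s≤s d≤u) (head≤ es∈))) (sym (*-identityˡ _))))
    (*-identityˡ _)
    where
    head≤ : ∀ {es} → es ∈ seqs (suc u) d → profileOf es 0 ≤ suc d
    head≤ es∈ with seqs-headed u d es∈
    ... | headed e≤d _ _ = m≤n⇒m≤1+n e≤d

  -- The factor is the hook of the entry cell, which lies on every path counted. For a path going
  -- left it yields the weight of the path entering one column earlier; for a path going down it
  -- completes the first row.
  pathSum-suc : ∀ u d → suc d ≤ u →
    pathSum (suc u) (suc d) * suc (2 * (u ∸ d)) ≡ pathSum (suc u) d + rowWeight u * pathSum u (suc d)
  pathSum-suc u d d<u = begin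
    pathSum (suc u) (suc d) * o
      ≡⟨ *-comm _ o ⟩
    o * sum (map w (seqs (suc u) (suc d)))
      ≡⟨ cong (λ v → o * sum (map w v)) (seqs-last u d d<u) ⟩
    o * sum (map w (seqs (suc u) d ++ map (suc d ∷_) (seqs u (suc d))))
      ≡⟨ cong (λ v → o * sum v) (map-++ w (seqs (suc u) d) _) ⟩
    o * sum (map w (seqs (suc u) d) ++ map w (map (suc d ∷_) (seqs u (suc d))))
      ≡⟨ cong (o *_) (sum-++ (map w (seqs (suc u) d)) _) ⟩
    o * (sum (map w (seqs (suc u) d)) + sum (map w (map (suc d ∷_) (seqs u (suc d)))))
      ≡⟨ *-distribˡ-+ o (sum (map w (seqs (suc u) d))) _ ⟩
    o * sum (map w (seqs (suc u) d)) + o * sum (map w (map (suc d ∷_) (seqs u (suc d))))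
      ≡⟨ cong₂ (λ v x → v + o * sum x) (seqs-left u d (<⇒≤ d<u)) (sym (map-∘ (seqs u (suc d)))) ⟩
    pathSum (suc u) d + o * sum (map (w ∘ (suc d ∷_)) (seqs u (suc d)))
      ≡⟨ cong (λ v → pathSum (suc u) d + v) (sum-map-scale o (rowWeight u) (seqs u (suc d))
           (λ {es} _ → pathWeight-up u (suc d) {es} (m≤n⇒m≤1+n d<u))) ⟩
    pathSum (suc u) d + rowWeight u * pathSum u (suc d) ∎
    where
    open ≡-Reasoning
    o = suc (2 * (u ∸ d))
    w = pathWeight (suc u) (suc d)

  -- Below the last cell of the first row there is no cell, so every path goes left. The factor
  -- equals 1 and is kept to match the general recurrence.
  pathSum-diagonal : ∀ u → pathSum (suc u) (suc u) * suc (2 * (u ∸ u)) ≡ pathSum (suc u) u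
  pathSum-diagonal u = trans (*-comm _ (suc (2 * (u ∸ u))))
    (trans (cong (λ v → suc (2 * (u ∸ u)) * sum (map (pathWeight (suc u) (suc u)) v)) (seqs-stable u))
           (seqs-left u u ≤-refl))

  rowWeight-nonZero : ∀ u → NonZero (rowWeight u)
  rowWeight-nonZero u = product≢0
    (All.map⁺ {f = λ j → stairHook (suc (suc u)) (1 , suc j)} (All.universal (λ _ → _) (upTo (suc (suc u)))))

  pathSum-nonZero : ∀ u → NonZero (pathSum u 0)
  pathSum-nonZero zero    = _
  pathSum-nonZero (suc u) = m*n≢0⇒m≢0 (pathSum (suc u) 0) {suc (2 * suc u)}
    {{subst NonZero (sym (pathSum-zero u)) (m*n≢0 (rowWeight u) (pathSum u 0)
        {{rowWeight-nonZero u}} {{pathSum-nonZero u}})}}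

  -- Matching the excited diagrams with the enumerated paths

  -- If `m′ (suc k)` were larger, the cell of row `suc k` in that column would be off the path of
  -- `m′` but on the path of `m`.
  profile-off≤ : ∀ {xs m m′} → Linked _≥_ xs → Profile xs m → Profile xs m′ →
    (∀ {z} → z ∈ off m′ xs → z ∈ off m xs) → ∀ k → m k ≡ m′ k → m′ (suc k) ≤ m (suc k)
  profile-off≤ {xs} {m} {m′} dec P P′ sub k e = ≮⇒≥ absurd
    where
    absurd : ¬ m (suc k) < m′ (suc k)
    absurd lt with ∈-off⁻ m xs (sub (∈-off⁺ m′ xs {suc k , m′ (suc k)} (from (∈-diagram xs)
      ( ≤-trans (s≤s z≤n) lt
      , ≤-trans (bounded P′ (suc k)) (≤-trans (m∸n≤m _ 1) (nth-mono dec k)))) (inj₁ ≤-refl)))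
    ... | _ , inj₁ ≤m  = <⇒≱ lt ≤m
    ... | _ , inj₂ m<  = <⇒≱ m< (≤-trans (antitone P′ k) (≤-trans (≤-reflexive (sym e)) (n≤1+n _)))

  off-injective : ∀ {xs m m′} → Linked _≥_ xs → Profile xs m → Profile xs m′ → off m xs ≡ off m′ xs → ∀ k → m k ≡ m′ k
  off-injective dec P P′ e zero    = trans (top P) (sym (top P′))
  off-injective {xs} dec P P′ e (suc k) = ≤-antisym
    (profile-off≤ dec P′ P (subst (_ ∈_) e) k (sym (off-injective dec P P′ e k)))
    (profile-off≤ dec P P′ (subst (_ ∈_) (sym e)) k (off-injective dec P P′ e k))

  -- By `top` the path reaches the end of row 1, so the off cells of this row are those left of the
  -- path.
  firstRow-off : ∀ {xs m D} → Linked _≥_ xs → Profile xs m → D ↭ off m xs → firstRow D ≡ m 1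
  firstRow-off {xs} {m} {D} dec P D↭ = begin
    firstRow D                                ≡⟨ ↭-length (filter-↭ row≟1 D↭) ⟩
    length (filter row≟1 (off m xs))          ≡⟨ ↭-length (unique∧⊆⇒↭ (Unique.filter⁺ row≟1 (off-unique m xs)) unique₂ forth back) ⟩
    length cells                              ≡⟨ length-map _ (upTo (m 1)) ⟩
    length (upTo (m 1))                       ≡⟨ length-upTo (m 1) ⟩
    m 1                                       ∎
    where
    open ≡-Reasoning
    row≟1 : (c : Cell) → Dec (row c ≡ 1)
    row≟1 c = row c ≟ 1
    cells : List Cell
    cells = map (λ j → 1 , suc j) (upTo (m 1))
    unique₂ : Unique cells
    unique₂ = Unique.map⁺ (λ { refl → refl }) (Unique.upTo⁺ (m 1))
    forth : ∀ {z} → z ∈ filter row≟1 (off m xs) → z ∈ cells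
    forth {z} z∈ with ∈-filter⁻ row≟1 {xs = off m xs} z∈
    ... | z∈off , refl with ∈-off⁻ m xs z∈off
    forth {_ , zero} z∈ | _ , refl | z∈xs , _ = contradiction z∈xs (0th∉diagram xs)
    forth {_ , suc j} z∈ | _ , refl | z∈xs , inj₁ j<m = ∈-map⁺ _ (∈-upTo⁺ j<m)
    forth {_ , suc j} z∈ | _ , refl | z∈xs , inj₂ m<j =
      contradiction (≤-trans (proj₂ (to (∈-diagram xs) z∈xs)) (subst (λ v → nth xs 1 ≤ suc v) (sym (top P)) (m≤n+m∸n _ 1))) (<⇒≱ m<j)
    back : ∀ {z} → z ∈ cells → z ∈ filter row≟1 (off m xs)
    back z∈ with ∈-map⁻ _ z∈
    ... | j , j∈ , refl with ∈-upTo⁻ j∈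
    ... | j<m = ∈-filter⁺ row≟1 (∈-off⁺ m xs (from (∈-diagram xs)
      (s≤s z≤n , ≤-trans j<m (≤-trans (bounded P 1) (≤-trans (m∸n≤m _ 1) (nth-mono dec 0))))) (inj₁ j<m)) refl

  module _ (a : ℕ) where

    private
      Λ = λ^ (odds a)
      xs = parts Λ

      xs≡ : xs ≡ suc a ∷ stair (suc a)
      xs≡ = parts-odds a

    s-odds : s (odds a) ≡ a
    s-odds = cong (λ v → nth v 1 ∸ 1) xs≡

    outermost-odds : ∀ k → nth xs (suc (suc k)) ∸ 1 ≡ a ∸ k
    outermost-odds k = trans (cong (λ v → nth v (suc (suc k)) ∸ 1) xs≡)
      (trans (cong (_∸ 1) (nth-stair (suc a) k))
      (trans (∸-+-assoc (suc a) k 1) (cong (suc a ∸_) (+-comm k 1))))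

    seqs-profile : ∀ {i es} → i ≤ a → es ∈ seqs a i → Profile xs (profileOf (a ∷ i ∷ es))
    seqs-profile {i} i≤a es∈ = record
      { top      = sym s-odds
      ; antitone = λ { zero → i≤a ; (suc k) → seqs-antitone a i es∈ k }
      ; bounded  = λ { zero → ≤-reflexive (sym s-odds)
                     ; (suc k) → ≤-trans (seqs-bounded a i i≤a es∈ k) (≤-reflexive (sym (outermost-odds k))) } }

    profile-seqs : ∀ {m i} → Profile xs m → m 1 ≡ i → ∃[ es ] es ∈ seqs a i × (∀ k → profileOf (a ∷ i ∷ es) k ≡ m k)
    profile-seqs {m} P refl with seqs-complete a (m ∘ suc) (antitone P ∘ suc)
      (λ k → ≤-trans (bounded P (suc k)) (≤-reflexive (outermost-odds k)))
    ... | es , es∈ , agree = es , es∈ , λ { zero → trans (sym s-odds) (sym (top P)) ; (suc k) → agree k }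

    excitedOf : ℕ → List ℕ → List Cell
    excitedOf i es = off (profileOf (a ∷ i ∷ es)) xs

    hookProduct-excitedOf : ∀ i es → hookProduct Λ (excitedOf i es) ≡ pathWeight a i es
    hookProduct-excitedOf i es = begin
      product (map (hook Λ) (filter row≢1 (off m xs)))
        ≡⟨ product-↭ (map⁺ (hook Λ) (unique∧⊆⇒↭ (Unique.filter⁺ row≢1 (off-unique m xs))
             (Unique.map⁺ (λ { refl → refl }) (off-unique m′ ys)) forth back)) ⟩
      product (map (hook Λ) (map below (off m′ ys)))
        ≡⟨ cong product (map-∘ {g = hook Λ} {f = below} (off m′ ys)) ⟨
      product (map (hook Λ ∘ below) (off m′ ys))
        ≡⟨ cong product (map-cong-local (All.tabulate λ c∈ → hook-below Λ xs≡ (proj₁ (∈-off⁻ m′ ys c∈)))) ⟩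
      pathWeight a i es ∎
      where
      open ≡-Reasoning
      ys = stair (suc a)
      m = profileOf (a ∷ i ∷ es)
      m′ = profileOf (i ∷ es)
      row≢1 : (c : Cell) → Dec (¬ row c ≡ 1)
      row≢1 c = ¬? (row c ≟ 1)
      below∈ : ∀ {k j} → (suc k , j) ∈ diagram ys → (suc (suc k) , j) ∈ diagram xs
      below∈ {k} {j} c∈ = subst (λ v → (suc (suc k) , j) ∈ diagram v) (sym xs≡)
        (from (∈-diagram (suc a ∷ ys)) (to (∈-diagram ys) c∈))
      above∈ : ∀ {k j} → (suc (suc k) , j) ∈ diagram xs → (suc k , j) ∈ diagram ys
      above∈ {k} {j} c∈ = from (∈-diagram ys)
        (to (∈-diagram (suc a ∷ ys)) (subst (λ v → (suc (suc k) , j) ∈ diagram v) xs≡ c∈))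
      forth : ∀ {z} → z ∈ filter row≢1 (off m xs) → z ∈ map below (off m′ ys)
      forth {z} z∈ with ∈-filter⁻ row≢1 {xs = off m xs} z∈
      ... | z∈off , r≢1 with ∈-off⁻ m xs z∈off
      forth {zero , _} z∈ | _ , r≢1 | z∈xs , _ = contradiction z∈xs (0∉diagram xs)
      forth {suc zero , _} z∈ | _ , r≢1 | z∈xs , _ = contradiction refl r≢1
      forth {suc (suc k) , j} z∈ | _ , r≢1 | z∈xs , o = ∈-map⁺ below (∈-off⁺ m′ ys (above∈ z∈xs) o)
      back : ∀ {z} → z ∈ map below (off m′ ys) → z ∈ filter row≢1 (off m xs)
      back z∈ with ∈-map⁻ below z∈
      ... | (zero , _) , c∈ , refl = contradiction (proj₁ (∈-off⁻ m′ ys c∈)) (0∉diagram ys)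
      ... | (suc k , j) , c∈ , refl with ∈-off⁻ m′ ys c∈
      ... | c∈ys , o = ∈-filter⁺ row≢1 (∈-off⁺ m xs (below∈ c∈ys) o) λ ()

    𝔼-odds : ∀ i → i ≤ a →
      filter (λ D → firstRow D + (a ∸ i) ≟ s (odds a)) (𝔼 Λ (inner Λ)) ↭ map (excitedOf i) (seqs a i)
    𝔼-odds i i≤a = unique∧⊆⇒↭
      (Unique.filter⁺ level? (Unique.filter⁺ (excited? Λ (inner Λ)) (subsets-unique (diagram-unique xs))))
      (map-unique-local (excitedOf i) injective (seqs-unique a i)) forth back
      where
      level? : (D : List Cell) → Dec (firstRow D + (a ∸ i) ≡ s (odds a))
      level? D = firstRow D + (a ∸ i) ≟ s (odds a)
      injective : ∀ {es fs} → es ∈ seqs a i → fs ∈ seqs a i → excitedOf i es ≡ excitedOf i fs → es ≡ fs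
      injective {es} {fs} es∈ fs∈ e = nth-ext es fs
        (trans (seqs-length a i es∈) (sym (seqs-length a i fs∈)))
        (λ k → off-injective (decreasing Λ) (seqs-profile i≤a es∈) (seqs-profile i≤a fs∈) e (suc (suc k)))
      forth : ∀ {D} → D ∈ filter level? (𝔼 Λ (inner Λ)) → D ∈ map (excitedOf i) (seqs a i)
      forth {D} D∈ with ∈-filter⁻ level? {xs = 𝔼 Λ (inner Λ)} D∈
      ... | D∈𝔼 , level with ∈-filter⁻ (excited? Λ (inner Λ)) {xs = subsets (𝔻 Λ)} D∈𝔼
      ... | D∈subsets , exc with excited⇒profile Λ exc
      ... | m , P , D↭ with profile-seqs P m1≡i
        where
        m1≡i : m 1 ≡ i
        m1≡i = trans (sym (firstRow-off (decreasing Λ) P D↭))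
          (+-cancelʳ-≡ (a ∸ i) _ _ (trans level (trans s-odds (sym (m+[n∸m]≡n i≤a)))))
      -- The profile determines `D` only up to `↭`; as `D` and `excitedOf i es` are both sublists of
      -- the diagram, they are equal.
      ... | es , es∈ , agree = subst (_∈ map (excitedOf i) (seqs a i))
        (sym (subsets-ext (diagram-unique xs) D∈subsets (filter∈subsets (Off? _) (diagram xs))
          (∈-resp-↭ D↭′) (∈-resp-↭ (↭-sym D↭′))))
        (∈-map⁺ (excitedOf i) es∈)
        where
        D↭′ : D ↭ excitedOf i es
        D↭′ = ↭-trans D↭ (↭-sym (off-cong xs agree))
      back : ∀ {D} → D ∈ map (excitedOf i) (seqs a i) → D ∈ filter level? (𝔼 Λ (inner Λ))
      back D∈ with ∈-map⁻ (excitedOf i) D∈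
      ... | es , es∈ , refl = ∈-filter⁺ level?
        (∈-filter⁺ (excited? Λ (inner Λ)) (filter∈subsets (Off? _) (diagram xs)) (profile⇒excited Λ P))
        (trans (cong (_+ (a ∸ i)) (firstRow-off (decreasing Λ) P ↭-refl)) (trans (m+[n∸m]≡n i≤a) (sym s-odds)))
        where
        P : Profile xs (profileOf (a ∷ i ∷ es))
        P = seqs-profile i≤a es∈

    C-odds : ∀ i → i ≤ a → C (odds a) (a ∸ i) ≡ pathSum a i
    C-odds i i≤a = begin
      sum (map (hookProduct Λ) (filter (λ D → firstRow D + (a ∸ i) ≟ s (odds a)) (𝔼 Λ (inner Λ))))
        ≡⟨ sum-↭ (map⁺ (hookProduct Λ) (𝔼-odds i i≤a)) ⟩
      sum (map (hookProduct Λ) (map (excitedOf i) (seqs a i)))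
        ≡⟨ cong sum (map-∘ {g = hookProduct Λ} {f = excitedOf i} (seqs a i)) ⟨
      sum (map (hookProduct Λ ∘ excitedOf i) (seqs a i))
        ≡⟨ cong sum (map-cong (hookProduct-excitedOf i) (seqs a i)) ⟩
      pathSum a i ∎
      where open ≡-Reasoning

theorem7p4 : (i : ℕ) →
    ∃! _≈_ λ P →
    DegreeAtMost i P ×
    ((a : ℕ) → i ≤ a →
    Σ (NonZero (C (odds a) a)) λ nz →
    eval P ((+ a) / 1) ≡ _/_ (+ C (odds a) (a ∸ i)) (C (odds a) a) {{nz}})
theorem7p4 = ∃!-ratio (λ a → C (odds a)) C-odds
  where
  open ExcitedDiagrams
  open RationalPolynomials.Ratios pathSum rowWeight pathSum-zero pathSum-suc pathSum-diagonal pathSum-nonZero
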